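{- Let $\mathfrak{K}$ be a finite family of (pairwise non-isomorphic) computable structures. If $\mathfrak{K}$ is learnable, then $\mathfrak{K}$ is learnable by a $\mathbf{0}'$-computable learner.
   Context: Structures. All structures considered are in a relational signature, i.e. a signature with no function symbols (the members of a family share one signature), and have as domain the set $\omega$ of natural numbers. A structure is identified with its atomic diagram (the collection of atomic formulas true of it), regarded via a Gödel numbering as a subset of $\omega$; it is computable if this set is computable. Two structures are copies of each other if they are isomorphic. For a structure $\mathcal{S}$ and $n\in\omega$, $\mathcal{S}\restriction_n$ denotes the finite substructure obtained by restricting $\mathcal{S}$ to the domain $\{0,1,\ldots,n\}$. Learning. Let $\mathfrak{K}$ be a finite family of pairwise non-isomorphic computable structures. - The learning domain is the collection of all copies of the structures from $\mathfrak{K}$: $\mathrm{LD}(\mathfrak{K})=\bigcup_{\mathcal{A}\in\mathfrak{K}}\{\mathcal{S} : \mathcal{S}\cong\mathcal{A}\}$. - The hypothesis space is $\mathrm{HS}(\mathfrak{K})=\{\ulcorner\mathcal{A}\urcorner : \mathcal{A}\in\mathfrak{K}\}\cup\{?\}$, which contains one formal symbol $\ulcorner\mathcal{A}\urcorner$ for each $\mathcal{A}\in\mathfrak{K}$ (a conjecture about the isomorphism type of the observed structure) and a question mark symbol. - A learner sees, by stages, all positive and negative data about a given structure in the learning domain and outputs conjectures; formally, it is a function $M$ from $\{\mathcal{S}\restriction_n : \mathcal{S}\in\mathrm{LD}(\mathfrak{K}),\ n\in\omega\}$ to $\mathrm{HS}(\mathfrak{K})$. In general $M$ can be a function of any complexity.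 - $M$ learns $\mathfrak{K}$ if for every $\mathcal{S}\in\mathrm{LD}(\mathfrak{K})$ and every $\mathcal{A}\in\mathfrak{K}$: $\lim_{n\to\infty}M(\mathcal{S}\restriction_n)=\ulcorner\mathcal{A}\urcorner$ (i.e. $M(\mathcal{S}\restriction_n)=\ulcorner\mathcal{A}\urcorner$ for all sufficiently large $n$) if and only if $\mathcal{S}$ is a copy of $\mathcal{A}$. - $\mathfrak{K}$ is learnable if some learner learns $\mathfrak{K}$; it is learnable by a $\mathbf{0}'$-computable learner if some learner that learns $\mathfrak{K}$ is computable with an oracle for the Halting set $\emptyset'$, whose Turing degree is $\mathbf{0}'$. -}

module Defs where

open import Level using (0ℓ)
open import Data.Bool using (Bool; T)
open import Data.Fin using (Fin; toℕ)
open import Data.List using (List; []; _∷_; map; concatMap; cartesianProductWith; filterᵇ; upTo; allFin)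
open import Data.Maybe using (Maybe; just; nothing)
open import Data.Nat using (ℕ; zero; suc; _+_; _*_; _^_; _≤_; _<_)
open import Data.Nat.ListAction using (sum)
open import Data.Product using (Σ; ∃-syntax; _×_; _,_)
open import Data.Vec as Vec using (Vec; []; _∷_)
open import Data.Vec.Relation.Binary.Pointwise.Inductive using (Pointwise)
open import Function.Bundles using (_↔_; _⇔_; Inverse)
open import Relation.Binary.PropositionalEquality using (_≡_; _≢_)
open import Relation.Nullary using (¬_)
open import Relation.Unary using (Pred; _∈_; _∉_; ∅)

-- Coding

-- An injection whose values are all positive, so that 0 is free to code the
-- empty sequence.
⟨_,_⟩ : ℕ → ℕ → ℕ
⟨ m , n ⟩ = 2 ^ m * (1 + 2 * n)

codeSeq : ∀ {k} → Vec ℕ k → ℕ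
codeSeq []       = 0
codeSeq (x ∷ xs) = ⟨ x , codeSeq xs ⟩

-- The canonical index of a finite set of numbers, given as a list without
-- repetitions: the sum of 2 ^ c over its elements c.
canonicalIndex : List ℕ → ℕ
canonicalIndex cs = sum (map (2 ^_) cs)

-- Computability relative to an oracle: Kleene's partial recursive functions,
-- with the characteristic function of the oracle as a further initial function

data Prog : ℕ → Set where
  zer    : Prog 0
  succ   : Prog 1
  proj   : ∀ {n} → Fin n → Prog n
  comp   : ∀ {m n} → Prog m → Vec (Prog n) m → Prog n
  prec   : ∀ {n} → Prog n → Prog (suc (suc n)) → Prog (suc n)
  mu     : ∀ {n} → Prog (suc n) → Prog n
  oracle : Prog 1

-- O ⊢ p [ xs ]↓ y : with oracle O, program p halts on inputs xs with output y.
data _⊢_[_]↓_ (O : Pred ℕ 0ℓ) : ∀ {n} → Prog n → Vec ℕ n → ℕ → Set where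
  zer    : O ⊢ zer [ [] ]↓ 0
  succ   : ∀ {x} → O ⊢ succ [ x ∷ [] ]↓ suc x
  proj   : ∀ {n} {i : Fin n} {xs} → O ⊢ proj i [ xs ]↓ Vec.lookup xs i
  comp   : ∀ {m n} {f : Prog m} {gs : Vec (Prog n) m} {xs ys z} →
           Pointwise (λ g y → O ⊢ g [ xs ]↓ y) gs ys →
           O ⊢ f [ ys ]↓ z →
           O ⊢ comp f gs [ xs ]↓ z
  prec-0 : ∀ {n} {g : Prog n} {h xs y} →
           O ⊢ g [ xs ]↓ y →
           O ⊢ prec g h [ 0 ∷ xs ]↓ y
  prec-s : ∀ {n} {g : Prog n} {h xs t z y} →
           O ⊢ prec g h [ t ∷ xs ]↓ z →
           O ⊢ h [ t ∷ z ∷ xs ]↓ y →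
           O ⊢ prec g h [ suc t ∷ xs ]↓ y
  mu     : ∀ {n} {f : Prog (suc n)} {xs y} →
           O ⊢ f [ y ∷ xs ]↓ 0 →
           (∀ z → z < y → ∃[ v ] O ⊢ f [ z ∷ xs ]↓ suc v) →
           O ⊢ mu f [ xs ]↓ y
  yes    : ∀ {x} → x ∈ O → O ⊢ oracle [ x ∷ [] ]↓ 1
  no     : ∀ {x} → x ∉ O → O ⊢ oracle [ x ∷ [] ]↓ 0

-- Injective on Prog n for each fixed n.
mutual
  code : ∀ {n} → Prog n → ℕ
  code zer         = ⟨ 0 , 0 ⟩
  code succ        = ⟨ 1 , 0 ⟩
  code (proj i)    = ⟨ 2 , toℕ i ⟩
  code (comp f gs) = ⟨ 3 , ⟨ code f , codes gs ⟩ ⟩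
  code (prec g h)  = ⟨ 4 , ⟨ code g , code h ⟩ ⟩
  code (mu f)      = ⟨ 5 , code f ⟩
  code oracle      = ⟨ 6 , 0 ⟩

  codes : ∀ {m n} → Vec (Prog n) m → ℕ
  codes []       = 0
  codes (g ∷ gs) = ⟨ code g , codes gs ⟩

-- The halting problem relative to O; numbers that are not of the form code p
-- index the nowhere defined function.
_′ : Pred ℕ 0ℓ → Pred ℕ 0ℓ
(O ′) c = ∃[ p ] ∃[ x ] ∃[ y ] (c ≡ ⟨ code {1} p , x ⟩ × O ⊢ p [ x ∷ [] ]↓ y)

∅′ : Pred ℕ 0ℓ
∅′ = ∅ ′

_≤T_ : Pred ℕ 0ℓ → Pred ℕ 0ℓ → Set
P ≤T O = ∃[ p ] ∀ x → (x ∈ P → O ⊢ p [ x ∷ [] ]↓ 1) × (x ∉ P → O ⊢ p [ x ∷ [] ]↓ 0)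

ComputableSet : Pred ℕ 0ℓ → Set
ComputableSet P = P ≤T ∅

-- Structures

-- Relational signatures, given by the arities of their symbols.
data Signature : Set where
  finite   : (k : ℕ) → (Fin k → ℕ) → Signature
  infinite : (ℕ → ℕ) → Signature

Symbol : Signature → Set
Symbol (finite k _) = Fin k
Symbol (infinite _) = ℕ

symbolNumber : ∀ σ → Symbol σ → ℕ
symbolNumber (finite _ _) r = toℕ r
symbolNumber (infinite _) r = r

arity : ∀ σ → Symbol σ → ℕ
arity (finite _ ar) = ar
arity (infinite ar) = ar

-- Relations are given by their characteristic functions. These need not be
-- computable; under excluded middle every relation on ℕ has one.
Structure : Signature → Set
Structure σ = (r : Symbol σ) → Vec ℕ (arity σ r) → Bool

_≅_ : ∀ {σ} → Structure σ → Structure σ → Set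
S ≅ A = Σ (ℕ ↔ ℕ) λ f → ∀ r xs → S r xs ≡ A r (Vec.map (Inverse.to f) xs)

Atom : Signature → Set
Atom σ = Σ (Symbol σ) λ r → Vec ℕ (arity σ r)

gödel : ∀ {σ} → Atom σ → ℕ
gödel {σ} (r , xs) = ⟨ symbolNumber σ r , codeSeq xs ⟩

holds : ∀ {σ} → Structure σ → Atom σ → Bool
holds S (r , xs) = S r xs

atomicDiagram : ∀ {σ} → Structure σ → Pred ℕ 0ℓ
atomicDiagram S c = ∃[ a ] (gödel a ≡ c × T (holds S a))

Computable : ∀ {σ} → Structure σ → Set
Computable S = ComputableSet (atomicDiagram S)

-- Restrictions

tuples : ℕ → (k : ℕ) → List (Vec ℕ k)
tuples n zero    = [] ∷ []
tuples n (suc k) = cartesianProductWith _∷_ (upTo (suc n)) (tuples n k)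

-- The symbols interpreted in the restriction to {0,…,n}: all of them if the
-- signature is finite. If it is infinite, only the first n + 1, which keeps the
-- restriction a finite object.
visible : ∀ σ → ℕ → List (Symbol σ)
visible (finite k _) n = allFin k
visible (infinite _) n = upTo (suc n)

atoms : ∀ σ → ℕ → List (Atom σ)
atoms σ n = concatMap (λ r → map (r ,_) (tuples n (arity σ r))) (visible σ n)

-- (n , D) stands for the structure with domain {0,…,n} whose true atomic
-- formulas are those listed in D. Its data are first-order, so a learner's
-- output depends only on the structure and not on how it is presented.
FinStr : Signature → Set
FinStr σ = ℕ × List (Atom σ)

_↾_ : ∀ {σ} → Structure σ → ℕ → FinStr σ
_↾_ {σ} S n = n , filterᵇ (holds S) (atoms σ n)

-- Learning

Family : Signature → ℕ → Set
Family σ k = Fin k → Structure σ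

PairwiseNonIsomorphic : ∀ {σ k} → Family σ k → Set
PairwiseNonIsomorphic K = ∀ i j → i ≢ j → ¬ (K i ≅ K j)

LD : ∀ {σ k} → Family σ k → Pred (Structure σ) 0ℓ
LD K S = ∃[ i ] S ≅ K i

-- just i is the conjecture ⌜ K i ⌝, and nothing is the question mark.
HS : ∀ {σ k} → Family σ k → Set
HS {k = k} K = Maybe (Fin k)

-- Values of a learner outside { S ↾ n : S ∈ LD K } are never consulted below.
Learner : ∀ {σ k} → Family σ k → Set
Learner {σ} K = FinStr σ → HS K

_on_ConvergesTo_ : ∀ {σ k} {K : Family σ k} → Learner K → Structure σ → HS K → Set
M on S ConvergesTo h = ∃[ N ] ∀ n → N ≤ n → M (S ↾ n) ≡ h

Learns : ∀ {σ k} (K : Family σ k) → Learner K → Set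
Learns K M = ∀ S → S ∈ LD K → ∀ i → (_on_ConvergesTo_ {K = K} M S (just i)) ⇔ (S ≅ K i)

codeFinStr : ∀ {σ} → FinStr σ → Vec ℕ 2
codeFinStr (n , D) = n ∷ canonicalIndex (map gödel D) ∷ []

codeHS : ∀ {σ k} (K : Family σ k) → HS K → ℕ
codeHS K nothing  = 0
codeHS K (just i) = suc (toℕ i)

_ComputableIn_ : ∀ {σ k} {K : Family σ k} → Learner K → Pred ℕ 0ℓ → Set
_ComputableIn_ {K = K} M O =
  ∃[ p ] ∀ S → S ∈ LD K → ∀ n → O ⊢ p [ codeFinStr (S ↾ n) ]↓ codeHS K (M (S ↾ n))

Learnable : ∀ {σ k} → Family σ k → Set
Learnable K = ∃[ M ] Learns K M

LearnableIn : ∀ {σ k} → Pred ℕ 0ℓ → Family σ k → Set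
LearnableIn O K = ∃[ M ] (Learns K M × _ComputableIn_ {K = K} M O)

{-# OPTIONS --safe #-}

-- Fix a learner M of the family and a member A. Some finite partial enumeration g of A, of length L,
-- locks M: on every enumeration of A that extends g, M conjectures A from stage L on. Otherwise
-- enumerations on which M errs could be extended again and again, converging to a copy of A which M
-- fails to learn. A tuple b in a structure S is refuted at stage n for A if no injection of {0,…,n}
-- into A sends b to the tuple g and respects the atomic facts about S visible at that stage. If S ≅ A,
-- the preimage of g is never refuted. If S is a copy of another member, every tuple b is refuted at
-- some stage: otherwise a copy of S starting with b looks, at every stage, like an extension of g, and
-- M wrongly converges to A on it. So the learner takes, at each stage, the least tuple that is not
-- refuted for all members, and conjectures the first member for which it is not refuted. Being
-- unrefuted is Σ₁, as the atomic diagrams are computable, and hence decided by one question to ∅′.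

module Submission where

open import Level using (0ℓ)
open import Axiom.ExcludedMiddle using (ExcludedMiddle)
open import Data.Bool using (Bool; true; false; T; if_then_else_)
open import Data.Bool.Properties using (T?)
open import Data.Fin using (Fin; zero; suc; toℕ)
import Data.Fin.Properties as Fin
open import Data.List as List using (List; []; _∷_; upTo; filterᵇ)
open import Data.List.Membership.Propositional using (find; lose) renaming (_∈_ to _∈ˡ_; _∉_ to _∉ˡ_)
open import Data.List.Membership.Propositional.Properties
open import Data.List.Relation.Unary.All as All using ([]; _∷_)
import Data.List.Relation.Unary.All.Properties as All
open import Data.List.Relation.Unary.AllPairs as AllPairs using ([]; _∷_)
import Data.List.Relation.Unary.AllPairs.Properties as AllPairs
open import Data.List.Relation.Unary.Any using (here; there)
open import Data.List.Relation.Unary.Unique.Propositional using (Unique)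
import Data.List.Relation.Unary.Unique.Propositional.Properties as Unique
open import Data.Maybe as Maybe using (Maybe; just; nothing; _<∣>_)
open import Data.Maybe.Properties using (just-injective)
open import Data.Nat
open import Data.Nat.GeneralisedArithmetic using (fold)
open import Data.Nat.Induction using (<-rec)
open import Data.Nat.Properties
open import Data.Product using (Σ; ∃; ∃-syntax; _×_; _,_; proj₁; proj₂)
open import Data.Sum using (_⊎_; inj₁; inj₂)
open import Data.Unit using (tt)
open import Data.Vec as Vec using (Vec; []; _∷_)
open import Data.Vec.Properties using (∷-injective; map-∘; map-cong; map-id)
open import Data.Vec.Relation.Binary.Pointwise.Inductive using (Pointwise; []; _∷_)
open import Function using (_∘_)
open import Function.Bundles using (_↔_; _⇔_; mk⇔; mk↔ₛ′; Equivalence; Inverse)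
open import Function.Construct.Composition using (_↔-∘_)
open import Function.Construct.Identity using (↔-id)
open import Function.Construct.Symmetry using (↔-sym)
open import Relation.Binary.Definitions using (tri<; tri≈; tri>)
open import Relation.Binary.PropositionalEquality hiding ([_])
open import Relation.Nullary using (¬_; Dec; contradiction) renaming (yes to yesᵈ; no to noᵈ)
open import Relation.Nullary.Decidable using (decidable-stable)
open import Relation.Unary using (Pred; _∈_; ∅)
open import Defs

-- Arithmetic of the codings

odd : ℕ → ℕ
odd 0             = 0
odd 1             = 1
odd (suc (suc n)) = odd n

-- The binary digit of `d` at place `e`. The lowest digit 1 of `⟨ m , n ⟩` is at place `m`, and the
-- digits 1 of a canonical index are at the elements of the set.
bit : ℕ → ℕ → ℕ
bit e d = odd (fold d ⌊_/2⌋ e)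

-- The least z with bit z d ≡ 1, searched for in d steps; head 0 ≡ 0 is a junk value.
head : ℕ → ℕ
head d = fold 0 (λ z → z + (1 ∸ bit z d)) d

tail : ℕ → ℕ
tail d = ⌊ fold d ⌊_/2⌋ (head d) /2⌋

nth : ℕ → ℕ → ℕ
nth c x = head (fold c tail x)

recℕ : ℕ → (ℕ → ℕ → ℕ) → ℕ → ℕ
recℕ z s zero    = z
recℕ z s (suc n) = s n (recℕ z s n)

-- The factor `1 ∸ (1 ∸ y)` is the sign of `y`: an exhausted suffix is sent to 0, the code of the
-- empty sequence.
mapStep : ℕ → ℕ → ℕ → ℕ
mapStep c y z = (1 ∸ (1 ∸ y)) * ⟨ nth c (head y) , z ⟩

-- The sequence coded by s is consumed from its end: stage j handles the suffix
-- obtained by dropping s ∸ j entries, so that the recursion is primitive.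
mapSeq : ℕ → ℕ → ℕ
mapSeq c s = recℕ 0 (λ j → mapStep c (fold s tail (s ∸ suc j))) s

tabulateSeq : (ℕ → ℕ) → ℕ → ℕ
tabulateSeq f zero    = 0
tabulateSeq f (suc n) = ⟨ f 0 , tabulateSeq (f ∘ suc) n ⟩

fold-shift : ∀ {A : Set} (f : A → A) x n → fold x f (suc n) ≡ fold (f x) f n
fold-shift f x zero    = refl
fold-shift f x (suc n) = cong f (fold-shift f x n)

odd-2*+ : ∀ m d → odd (2 * m + d) ≡ odd d
odd-2*+ zero    d = refl
odd-2*+ (suc m) d rewrite +-suc m (m + 0) = odd-2*+ m d

⌊2*+/2⌋ : ∀ m d → ⌊ 2 * m + d /2⌋ ≡ m + ⌊ d /2⌋
⌊2*+/2⌋ zero    d = refl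
⌊2*+/2⌋ (suc m) d rewrite +-suc m (m + 0) = cong suc (⌊2*+/2⌋ m d)

odd-2* : ∀ m → odd (2 * m) ≡ 0
odd-2* m = trans (cong odd (sym (+-identityʳ (2 * m)))) (odd-2*+ m 0)

⌊2*/2⌋ : ∀ m → ⌊ 2 * m /2⌋ ≡ m
⌊2*/2⌋ m = trans (cong ⌊_/2⌋ (sym (+-identityʳ (2 * m)))) (trans (⌊2*+/2⌋ m 0) (+-identityʳ m))

odd-1+2* : ∀ m → odd (1 + 2 * m) ≡ 1
odd-1+2* m = trans (cong odd (+-comm 1 (2 * m))) (odd-2*+ m 1)

⌊1+2*/2⌋ : ∀ m → ⌊ 1 + 2 * m /2⌋ ≡ m
⌊1+2*/2⌋ m = trans (cong ⌊_/2⌋ (+-comm 1 (2 * m))) (trans (⌊2*+/2⌋ m 1) (+-identityʳ m))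

⟨suc,⟩ : ∀ m n → ⟨ suc m , n ⟩ ≡ 2 * ⟨ m , n ⟩
⟨suc,⟩ m n = *-assoc 2 (2 ^ m) (1 + 2 * n)

⟨0,⟩ : ∀ n → ⟨ 0 , n ⟩ ≡ 1 + 2 * n
⟨0,⟩ n = *-identityˡ (1 + 2 * n)

halve-⟨,⟩ : ∀ m n → fold ⟨ m , n ⟩ ⌊_/2⌋ m ≡ 1 + 2 * n
halve-⟨,⟩ zero    n = ⟨0,⟩ n
halve-⟨,⟩ (suc m) n = begin
  fold ⟨ suc m , n ⟩ ⌊_/2⌋ (suc m)   ≡⟨ fold-shift ⌊_/2⌋ ⟨ suc m , n ⟩ m ⟩
  fold ⌊ ⟨ suc m , n ⟩ /2⌋ ⌊_/2⌋ m   ≡⟨ cong (λ x → fold ⌊ x /2⌋ ⌊_/2⌋ m) (⟨suc,⟩ m n) ⟩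
  fold ⌊ 2 * ⟨ m , n ⟩ /2⌋ ⌊_/2⌋ m   ≡⟨ cong (λ x → fold x ⌊_/2⌋ m) (⌊2*/2⌋ ⟨ m , n ⟩) ⟩
  fold ⟨ m , n ⟩ ⌊_/2⌋ m             ≡⟨ halve-⟨,⟩ m n ⟩
  1 + 2 * n                          ∎
  where open ≡-Reasoning

bit-suc : ∀ e d → bit (suc e) d ≡ bit e ⌊ d /2⌋
bit-suc e d = cong odd (fold-shift ⌊_/2⌋ d e)

bit-⟨,⟩-≡ : ∀ m n → bit m ⟨ m , n ⟩ ≡ 1
bit-⟨,⟩-≡ m n = trans (cong odd (halve-⟨,⟩ m n)) (odd-1+2* n)

bit-⟨,⟩-< : ∀ {x} m n → x < m → bit x ⟨ m , n ⟩ ≡ 0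
bit-⟨,⟩-< {zero}  (suc m) n _ = trans (cong odd (⟨suc,⟩ m n)) (odd-2* ⟨ m , n ⟩)
bit-⟨,⟩-< {suc x} (suc m) n (s≤s x<m) =
  trans (bit-suc x ⟨ suc m , n ⟩)
    (trans (cong (bit x) (trans (cong ⌊_/2⌋ (⟨suc,⟩ m n)) (⌊2*/2⌋ ⟨ m , n ⟩)))
      (bit-⟨,⟩-< m n x<m))

n<2^n : ∀ n → n < 2 ^ n
n<2^n zero    = s≤s z≤n
n<2^n (suc n) = ≤-trans (+-mono-≤ (≤-trans (s≤s z≤n) (n<2^n n)) (n<2^n n))
                        (≤-reflexive (cong (2 ^ n +_) (sym (+-identityʳ (2 ^ n)))))

m<⟨m,n⟩ : ∀ m n → m < ⟨ m , n ⟩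
m<⟨m,n⟩ m n = ≤-trans (n<2^n m) (m≤m*n (2 ^ m) (1 + 2 * n))

n<⟨m,n⟩ : ∀ m n → n < ⟨ m , n ⟩
n<⟨m,n⟩ m n = ≤-trans (s≤s (m≤m+n n (n + 0)))
                      (m≤n*m (1 + 2 * n) (2 ^ m) {{m^n≢0 2 m}})

-- The counter advances while the digit it points at is 0 and is stuck at the lowest digit 1.
head-search : ∀ m n N → fold 0 (λ z → z + (1 ∸ bit z ⟨ m , n ⟩)) N ≡ N ⊓ m
head-search m n zero = refl
head-search m n (suc N) rewrite head-search m n N with <-≤-connex N m
... | inj₁ N<m rewrite m≤n⇒m⊓n≡m (<⇒≤ N<m) | m≤n⇒m⊓n≡m N<m | bit-⟨,⟩-< m n N<m = +-comm N 1
... | inj₂ m≤N rewrite m≥n⇒m⊓n≡n m≤N | m≥n⇒m⊓n≡n (m≤n⇒m≤1+n m≤N) | bit-⟨,⟩-≡ m n = +-identityʳ m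

head-⟨,⟩ : ∀ m n → head ⟨ m , n ⟩ ≡ m
head-⟨,⟩ m n = trans (head-search m n ⟨ m , n ⟩) (m≥n⇒m⊓n≡n (<⇒≤ (m<⟨m,n⟩ m n)))

tail-⟨,⟩ : ∀ m n → tail ⟨ m , n ⟩ ≡ n
tail-⟨,⟩ m n = begin
  ⌊ fold ⟨ m , n ⟩ ⌊_/2⌋ (head ⟨ m , n ⟩) /2⌋  ≡⟨ cong (λ x → ⌊ fold ⟨ m , n ⟩ ⌊_/2⌋ x /2⌋) (head-⟨,⟩ m n) ⟩
  ⌊ fold ⟨ m , n ⟩ ⌊_/2⌋ m /2⌋                 ≡⟨ cong ⌊_/2⌋ (halve-⟨,⟩ m n) ⟩
  ⌊ 1 + 2 * n /2⌋                              ≡⟨ ⌊1+2*/2⌋ n ⟩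
  n                                            ∎
  where open ≡-Reasoning

⟨,⟩-injective : ∀ m n m′ n′ → ⟨ m , n ⟩ ≡ ⟨ m′ , n′ ⟩ → m ≡ m′ × n ≡ n′
⟨,⟩-injective m n m′ n′ eq =
  trans (sym (head-⟨,⟩ m n)) (trans (cong head eq) (head-⟨,⟩ m′ n′)) ,
  trans (sym (tail-⟨,⟩ m n)) (trans (cong tail eq) (tail-⟨,⟩ m′ n′))

0≢⟨,⟩ : ∀ m n → 0 ≢ ⟨ m , n ⟩
0≢⟨,⟩ m n eq = contradiction (subst (m <_) (sym eq) (m<⟨m,n⟩ m n)) λ ()

even-or-odd : ∀ n → ∃[ h ] (n ≡ 2 * h ⊎ n ≡ 1 + 2 * h)
even-or-odd zero = 0 , inj₁ refl
even-or-odd (suc n) with even-or-odd n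
... | h , inj₁ eq = h , inj₂ (cong suc eq)
... | h , inj₂ eq = suc h , inj₁ (trans (cong suc eq) (cong suc (sym (+-suc h (h + 0)))))

-- Strong induction by halving: an odd number has first component 0, and halving a positive even
-- number lowers the first component by one.
⟨,⟩-surjective : ∀ s → s ≢ 0 → ∃[ m ] ∃[ n ] s ≡ ⟨ m , n ⟩
⟨,⟩-surjective = <-rec _ step
  where
  step : ∀ s → (∀ {t} → t < s → t ≢ 0 → ∃[ m ] ∃[ n ] t ≡ ⟨ m , n ⟩) →
         s ≢ 0 → ∃[ m ] ∃[ n ] s ≡ ⟨ m , n ⟩
  step s rec s≢0 with even-or-odd s
  ... | h     , inj₂ eq = 0 , h , trans eq (sym (⟨0,⟩ h))
  ... | zero  , inj₁ eq = contradiction eq s≢0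
  ... | suc h , inj₁ eq
    with rec (subst (suc h <_) (sym eq) (m<m+n (suc h) (s≤s z≤n))) (λ ())
  ... | m , n , eq′ = suc m , n , trans eq (trans (cong (2 *_) eq′) (sym (⟨suc,⟩ m n)))

-- A positive number is a pair with a smaller second component. Hence the embedding test may let `s`
-- range over all numbers.
codeSeq-surjective : ∀ s → ∃[ k ] ∃ λ (xs : Vec ℕ k) → codeSeq xs ≡ s
codeSeq-surjective = <-rec _ step
  where
  step : ∀ s → (∀ {t} → t < s → ∃[ k ] ∃ λ (xs : Vec ℕ k) → codeSeq xs ≡ t) →
         ∃[ k ] ∃ λ (xs : Vec ℕ k) → codeSeq xs ≡ s
  step zero      _   = 0 , [] , refl
  step s@(suc _) rec with ⟨,⟩-surjective s (λ ())
  ... | m , n , s≡ with rec (subst (n <_) (sym s≡) (n<⟨m,n⟩ m n))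
  ... | k , xs , eq = suc k , m ∷ xs , trans (cong ⟨ m ,_⟩ eq) (sym s≡)

-- As 0 is not a pair, a code determines the length as well; no common length is presupposed.
codeSeq-injective : ∀ {k l} (xs : Vec ℕ k) (ys : Vec ℕ l) → codeSeq xs ≡ codeSeq ys →
                    (k , xs) ≡ (l , ys)
codeSeq-injective []       []       eq = refl
codeSeq-injective []       (y ∷ ys) eq = contradiction eq (0≢⟨,⟩ y (codeSeq ys))
codeSeq-injective (x ∷ xs) []       eq = contradiction (sym eq) (0≢⟨,⟩ x (codeSeq xs))
codeSeq-injective (x ∷ xs) (y ∷ ys) eq
  with ⟨,⟩-injective x (codeSeq xs) y (codeSeq ys) eq
... | refl , eq′ with codeSeq-injective xs ys eq′
... | refl = refl

length≤codeSeq : ∀ {k} (xs : Vec ℕ k) → k ≤ codeSeq xs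
length≤codeSeq []       = z≤n
length≤codeSeq (x ∷ xs) = ≤-trans (s≤s (length≤codeSeq xs)) (n<⟨m,n⟩ x (codeSeq xs))

nth-tabulateSeq : ∀ f n {x} → x < n → nth (tabulateSeq f n) x ≡ f x
nth-tabulateSeq f (suc n) {zero}  _         = head-⟨,⟩ (f 0) (tabulateSeq (f ∘ suc) n)
nth-tabulateSeq f (suc n) {suc x} (s≤s x<n) = begin
  head (fold ⟨ f 0 , t ⟩ tail (suc x))   ≡⟨ cong head (fold-shift tail ⟨ f 0 , t ⟩ x) ⟩
  head (fold (tail ⟨ f 0 , t ⟩) tail x)  ≡⟨ cong (λ y → head (fold y tail x)) (tail-⟨,⟩ (f 0) t) ⟩
  head (fold t tail x)                   ≡⟨ nth-tabulateSeq (f ∘ suc) n x<n ⟩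
  f (suc x)                              ∎
  where
  open ≡-Reasoning
  t = tabulateSeq (f ∘ suc) n

mapSeq-codeSeq : ∀ c {k} (xs : Vec ℕ k) →
                 mapSeq c (codeSeq xs) ≡ codeSeq (Vec.map (nth c) xs)
mapSeq-codeSeq c xs =
  stage s ≤-refl xs (length≤codeSeq xs) (cong (fold s tail) (n∸n≡0 s))
  where
  s = codeSeq xs

  -- The invariant `l ≤ j` ensures that stage 0 meets only the empty suffix; `length≤codeSeq`
  -- provides it at the start.
  stage : ∀ j → j ≤ s → ∀ {l} (zs : Vec ℕ l) → l ≤ j → fold s tail (s ∸ j) ≡ codeSeq zs →
          recℕ 0 (λ j → mapStep c (fold s tail (s ∸ suc j))) j ≡ codeSeq (Vec.map (nth c) zs)
  stage zero    _   []       _         _  = refl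
  stage (suc j) _   []       _         eq = cong (λ y → mapStep c y (recℕ 0 (λ j → mapStep c (fold s tail (s ∸ suc j))) j)) eq
  stage (suc j) j<s (z ∷ zs) (s≤s l≤j) eq rewrite eq =
    trans (cong₂ (λ x r → (1 ∸ (1 ∸ ⟨ z , codeSeq zs ⟩)) * ⟨ nth c x , r ⟩)
                 (head-⟨,⟩ z (codeSeq zs))
                 (stage j (<⇒≤ j<s) zs l≤j dropped))
          (positive (m<⟨m,n⟩ z (codeSeq zs)))
    where
    dropped : fold s tail (s ∸ j) ≡ codeSeq zs
    dropped = trans (cong (fold s tail) (+-∸-assoc 1 j<s))
                    (trans (cong tail eq) (tail-⟨,⟩ z (codeSeq zs)))
    positive : ∀ {x y w} → x < y → (1 ∸ (1 ∸ y)) * w ≡ w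
    positive {y = suc y} {w} _ rewrite 0∸n≡0 y = +-identityʳ w

-- Recursive functions

-- A total function bundled with a program for it, so that programs are assembled by combinators
-- that mirror the expression computed.
record Recursive (O : Pred ℕ 0ℓ) {n} (f : Vec ℕ n → ℕ) : Set where
  constructor _computes_
  field
    program : Prog n
    halts   : ∀ xs → O ⊢ program [ xs ]↓ f xs

open Recursive

record Recursives (O : Pred ℕ 0ℓ) {m n} (F : Vec ℕ m → Vec ℕ n) : Set where
  constructor _computes_
  field
    programs : Vec (Prog m) n
    halts    : ∀ xs → Pointwise (λ p y → O ⊢ p [ xs ]↓ y) programs (F xs)

module _ {O : Pred ℕ 0ℓ} where

  ext : ∀ {n} {f g : Vec ℕ n → ℕ} → (∀ xs → f xs ≡ g xs) → Recursive O f → Recursive O g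
  ext f≗g (p computes h) = p computes λ xs → subst (O ⊢ p [ xs ]↓_) (f≗g xs) (h xs)

  var : ∀ {n} (i : Fin n) → Recursive O (λ xs → Vec.lookup xs i)
  var i = proj i computes λ _ → proj

  infixr 5 _∷ʳ_
  _∷ʳ_ : ∀ {m n} {f : Vec ℕ m → ℕ} {F : Vec ℕ m → Vec ℕ n} →
         Recursive O f → Recursives O F → Recursives O (λ xs → f xs ∷ F xs)
  (p computes h) ∷ʳ (ps computes hs) = (p ∷ ps) computes λ xs → h xs ∷ hs xs

  -- Stated through lookups so that it covers the identity and `Vec.tail`, which are not given as
  -- tabulations.
  projections : ∀ {m n} (ρ : Fin n → Fin m) {F : Vec ℕ m → Vec ℕ n} →
                (∀ xs i → Vec.lookup xs (ρ i) ≡ Vec.lookup (F xs) i) → Recursives O F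
  projections ρ {F} eq =
    Vec.tabulate (proj ∘ ρ) computes λ xs → pointwise ρ xs (F xs) (eq xs)
    where
    pointwise : ∀ {m n} (ρ : Fin n → Fin m) xs ys → (∀ i → Vec.lookup xs (ρ i) ≡ Vec.lookup ys i) →
                Pointwise (λ p y → O ⊢ p [ xs ]↓ y) (Vec.tabulate (proj ∘ ρ)) ys
    pointwise ρ xs []       _  = []
    pointwise ρ xs (y ∷ ys) eq =
      subst (O ⊢ proj (ρ zero) [ xs ]↓_) (eq zero) proj ∷ pointwise (ρ ∘ suc) xs ys (eq ∘ suc)

  _[_]ʳ : ∀ {m n} {f : Vec ℕ n → ℕ} {F : Vec ℕ m → Vec ℕ n} →
          Recursive O f → Recursives O F → Recursive O (λ xs → f (F xs))
  _[_]ʳ {F = F} (p computes h) (ps computes hs) = comp p ps computes λ xs → comp (hs xs) (h (F xs))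

  identityʳ : ∀ {n} → Recursives O {n} (λ xs → xs)
  identityʳ = projections (λ i → i) (λ _ _ → refl)

  dropʳ : ∀ {n} → Recursives O {suc n} Vec.tail
  dropʳ = projections suc λ { (_ ∷ _) _ → refl }

  drop₂ʳ : ∀ {n} → Recursives O {suc (suc n)} (λ xs → Vec.tail (Vec.tail xs))
  drop₂ʳ = projections (λ i → suc (suc i)) λ { (_ ∷ _ ∷ _) _ → refl }

  weaken : ∀ {n} {f : Vec ℕ n → ℕ} → Recursive O f → Recursive O (λ xs → f (Vec.tail xs))
  weaken f = f [ dropʳ ]ʳ

  sucʳ : ∀ {n} {f : Vec ℕ n → ℕ} → Recursive O f → Recursive O (λ xs → suc (f xs))
  sucʳ (p computes h) = comp succ (p ∷ []) computes λ xs → comp (h xs ∷ []) succ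

  lit : ∀ {n} (k : ℕ) → Recursive O {n} (λ _ → k)
  lit zero    = comp zer [] computes λ _ → comp [] zer
  lit (suc k) = sucʳ (lit k)

  recʳ : ∀ {n} {f z : Vec ℕ n → ℕ} {s : Vec ℕ (suc (suc n)) → ℕ} →
         Recursive O f → Recursive O z → Recursive O s →
         Recursive O (λ xs → recℕ (z xs) (λ t y → s (t ∷ y ∷ xs)) (f xs))
  recʳ {n} {f} {z} {s} f′ (p computes hz) (q computes hs) =
    (prec p q computes run) [ f′ ∷ʳ identityʳ ]ʳ
    where
    value : Vec ℕ (suc n) → ℕ
    value ys = recℕ (z (Vec.tail ys)) (λ t y → s (t ∷ y ∷ Vec.tail ys)) (Vec.head ys)

    run : ∀ ys → O ⊢ prec p q [ ys ]↓ value ys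
    run (zero  ∷ xs) = prec-0 (hz xs)
    run (suc t ∷ xs) = prec-s (run (t ∷ xs)) (hs (t ∷ value (t ∷ xs) ∷ xs))

  foldʳ : ∀ {n} {f z : Vec ℕ n → ℕ} {s : Vec ℕ (suc n) → ℕ} →
          Recursive O f → Recursive O z → Recursive O s →
          Recursive O (λ xs → fold (z xs) (λ y → s (y ∷ xs)) (f xs))
  foldʳ {f = f} {z} {s} f′ z′ s′ = ext (λ xs → agree xs (f xs)) (recʳ f′ z′ (weaken s′))
    where
    agree : ∀ xs n → recℕ (z xs) (λ _ y → s (y ∷ xs)) n ≡ fold (z xs) (λ y → s (y ∷ xs)) n
    agree xs zero    = refl
    agree xs (suc n) = cong (λ y → s (y ∷ xs)) (agree xs n)

  infixl 6 _+ʳ_ _∸ʳ_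
  infixl 7 _*ʳ_

  _+ʳ_ : ∀ {n} {f g : Vec ℕ n → ℕ} → Recursive O f → Recursive O g → Recursive O (λ xs → f xs + g xs)
  _+ʳ_ {f = f} {g} f′ g′ = ext (λ xs → agree (g xs) (f xs)) (foldʳ f′ g′ (sucʳ (var zero)))
    where
    agree : ∀ b a → fold b suc a ≡ a + b
    agree b zero    = refl
    agree b (suc a) = cong suc (agree b a)

  _*ʳ_ : ∀ {n} {f g : Vec ℕ n → ℕ} → Recursive O f → Recursive O g → Recursive O (λ xs → f xs * g xs)
  _*ʳ_ {f = f} {g} f′ g′ =
    ext (λ xs → agree (g xs) (f xs)) (foldʳ f′ (lit 0) (weaken g′ +ʳ var zero))
    where
    agree : ∀ b a → fold 0 (b +_) a ≡ a * b
    agree b zero    = refl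
    agree b (suc a) = cong (b +_) (agree b a)

  predʳ : ∀ {n} {f : Vec ℕ n → ℕ} → Recursive O f → Recursive O (λ xs → pred (f xs))
  predʳ {f = f} f′ = ext (λ xs → agree (f xs)) (recʳ f′ (lit 0) (var zero))
    where
    agree : ∀ a → recℕ 0 (λ t _ → t) a ≡ pred a
    agree zero    = refl
    agree (suc a) = refl

  _∸ʳ_ : ∀ {n} {f g : Vec ℕ n → ℕ} → Recursive O f → Recursive O g → Recursive O (λ xs → f xs ∸ g xs)
  _∸ʳ_ {f = f} {g} f′ g′ = ext (λ xs → agree (f xs) (g xs)) (foldʳ g′ f′ (predʳ (var zero)))
    where
    agree : ∀ a b → fold a pred b ≡ a ∸ b
    agree a zero    = refl
    agree a (suc b) = trans (cong pred (agree a b)) (pred[m∸n]≡m∸[1+n] a b)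

  2^ʳ : ∀ {n} {f : Vec ℕ n → ℕ} → Recursive O f → Recursive O (λ xs → 2 ^ f xs)
  2^ʳ {f = f} f′ = ext (λ xs → agree (f xs)) (foldʳ f′ (lit 1) (lit 2 *ʳ var zero))
    where
    agree : ∀ a → fold 1 (2 *_) a ≡ 2 ^ a
    agree zero    = refl
    agree (suc a) = cong (2 *_) (agree a)

  ⟨_,_⟩ʳ : ∀ {n} {f g : Vec ℕ n → ℕ} → Recursive O f → Recursive O g → Recursive O (λ xs → ⟨ f xs , g xs ⟩)
  ⟨ f′ , g′ ⟩ʳ = 2^ʳ f′ *ʳ sucʳ (lit 2 *ʳ g′)

  -- The two-step recursion of `odd` is recast as iteration of `1 ∸_`, since parity alternates.
  oddʳ : ∀ {n} {f : Vec ℕ n → ℕ} → Recursive O f → Recursive O (λ xs → odd (f xs))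
  oddʳ {f = f} f′ = ext (λ xs → agree (f xs)) (foldʳ f′ (lit 0) (lit 1 ∸ʳ var zero))
    where
    odd-suc : ∀ a → 1 ∸ odd a ≡ odd (suc a)
    odd-suc zero          = refl
    odd-suc (suc zero)    = refl
    odd-suc (suc (suc a)) = odd-suc a

    agree : ∀ a → fold 0 (1 ∸_) a ≡ odd a
    agree zero    = refl
    agree (suc a) = trans (cong (1 ∸_) (agree a)) (odd-suc a)

  ⌊_/2⌋ʳ : ∀ {n} {f : Vec ℕ n → ℕ} → Recursive O f → Recursive O (λ xs → ⌊ f xs /2⌋)
  ⌊_/2⌋ʳ {f = f} f′ = ext (λ xs → agree (f xs)) (recʳ f′ (lit 0) (oddʳ (var zero) +ʳ var (suc zero)))
    where
    half-suc : ∀ a → odd a + ⌊ a /2⌋ ≡ ⌊ suc a /2⌋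
    half-suc zero          = refl
    half-suc (suc zero)    = refl
    half-suc (suc (suc a)) = trans (+-suc (odd a) ⌊ a /2⌋) (cong suc (half-suc a))

    agree : ∀ a → recℕ 0 (λ t y → odd t + y) a ≡ ⌊ a /2⌋
    agree zero    = refl
    agree (suc a) = trans (cong (odd a +_) (agree a)) (half-suc a)

  bitʳ : ∀ {n} {f g : Vec ℕ n → ℕ} → Recursive O f → Recursive O g → Recursive O (λ xs → bit (f xs) (g xs))
  bitʳ e d = oddʳ (foldʳ e d ⌊ var zero /2⌋ʳ)

  headʳ : ∀ {n} {f : Vec ℕ n → ℕ} → Recursive O f → Recursive O (λ xs → head (f xs))
  headʳ d = foldʳ d (lit 0) (var zero +ʳ (lit 1 ∸ʳ bitʳ (var zero) (weaken d)))

  tailʳ : ∀ {n} {f : Vec ℕ n → ℕ} → Recursive O f → Recursive O (λ xs → tail (f xs))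
  tailʳ d = ⌊ foldʳ (headʳ d) d ⌊ var zero /2⌋ʳ /2⌋ʳ

  nthʳ : ∀ {n} {f g : Vec ℕ n → ℕ} → Recursive O f → Recursive O g → Recursive O (λ xs → nth (f xs) (g xs))
  nthʳ c x = headʳ (foldʳ x c (tailʳ (var zero)))

  mapSeqʳ : ∀ {n} {f g : Vec ℕ n → ℕ} → Recursive O f → Recursive O g → Recursive O (λ xs → mapSeq (f xs) (g xs))
  mapSeqʳ {n} {f} {g} c s =
    recʳ s (lit 0) ((lit 1 ∸ʳ (lit 1 ∸ʳ suffix)) *ʳ ⟨ nthʳ (weaken (weaken c)) (headʳ suffix) , var (suc zero) ⟩ʳ)
    where
    suffix : Recursive O {suc (suc n)}
               (λ xs → fold (g (Vec.tail (Vec.tail xs))) tail (g (Vec.tail (Vec.tail xs)) ∸ suc (Vec.lookup xs zero)))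
    suffix = foldʳ (weaken (weaken s) ∸ʳ sucʳ (var zero)) (weaken (weaken s)) (tailʳ (var zero))

sumBelow : ℕ → (ℕ → ℕ) → ℕ
sumBelow n f = recℕ 0 (λ i s → f i + s) n

sumʳ : ∀ {O n} {f : Vec ℕ n → ℕ} {g : Vec ℕ (suc n) → ℕ} →
       Recursive O f → Recursive O g → Recursive O (λ xs → sumBelow (f xs) (λ i → g (i ∷ xs)))
sumʳ f′ g′ = recʳ f′ (lit 0) (g′ [ var zero ∷ʳ drop₂ʳ ]ʳ +ʳ var (suc zero))

-- The halting problem

module _ {O : Pred ℕ 0ℓ} where

  mutual
    ↓-deterministic : ∀ {n} {p : Prog n} {xs y z} → O ⊢ p [ xs ]↓ y → O ⊢ p [ xs ]↓ z → y ≡ z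
    ↓-deterministic zer zer = refl
    ↓-deterministic succ succ = refl
    ↓-deterministic proj proj = refl
    ↓-deterministic (comp gs f) (comp gs′ f′) with ↓-deterministic* gs gs′
    ... | refl = ↓-deterministic f f′
    ↓-deterministic (prec-0 g) (prec-0 g′) = ↓-deterministic g g′
    ↓-deterministic (prec-s r h) (prec-s r′ h′) with ↓-deterministic r r′
    ... | refl = ↓-deterministic h h′
    -- If the two values differed, the program would output both 0 and a successor at the smaller
    -- one.
    ↓-deterministic (mu {y = y} f below) (mu {y = z} f′ below′) with <-cmp y z
    ... | tri< y<z _ _ with () ← ↓-deterministic f (proj₂ (below′ y y<z))
    ... | tri≈ _ y≡z _ = y≡z
    ... | tri> _ _ z<y with () ← ↓-deterministic (proj₂ (below z z<y)) f′
    ↓-deterministic (yes _)  (yes _)  = refl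
    ↓-deterministic (yes x∈) (no x∉)  = contradiction x∈ x∉
    ↓-deterministic (no x∉)  (yes x∈) = contradiction x∈ x∉
    ↓-deterministic (no _)   (no _)   = refl

    ↓-deterministic* : ∀ {m n} {ps : Vec (Prog n) m} {xs ys zs} →
                       Pointwise (λ p y → O ⊢ p [ xs ]↓ y) ps ys →
                       Pointwise (λ p z → O ⊢ p [ xs ]↓ z) ps zs → ys ≡ zs
    ↓-deterministic* []       []         = refl
    ↓-deterministic* (p ∷ ps) (p′ ∷ ps′) = cong₂ _∷_ (↓-deterministic p p′) (↓-deterministic* ps ps′)

-- Splitting a code into constructor number and argument reduces every mismatched pair of
-- constructors to an absurd equation between numerals.
tag : ∀ {n} → Prog n → ℕ
tag zer        = 0
tag succ       = 1
tag (proj _)   = 2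
tag (comp _ _) = 3
tag (prec _ _) = 4
tag (mu _)     = 5
tag oracle     = 6

body : ∀ {n} → Prog n → ℕ
body zer         = 0
body succ        = 0
body (proj i)    = toℕ i
body (comp f gs) = ⟨ code f , codes gs ⟩
body (prec g h)  = ⟨ code g , code h ⟩
body (mu f)      = code f
body oracle      = 0

code≡⟨tag,body⟩ : ∀ {n} (p : Prog n) → code p ≡ ⟨ tag p , body p ⟩
code≡⟨tag,body⟩ zer        = refl
code≡⟨tag,body⟩ succ       = refl
code≡⟨tag,body⟩ (proj _)   = refl
code≡⟨tag,body⟩ (comp _ _) = refl
code≡⟨tag,body⟩ (prec _ _) = refl
code≡⟨tag,body⟩ (mu _)     = refl
code≡⟨tag,body⟩ oracle     = refl

code-inversion : ∀ {n} (p q : Prog n) → code p ≡ code q → tag p ≡ tag q × body p ≡ body q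
code-inversion p q eq =
  ⟨,⟩-injective (tag p) (body p) (tag q) (body q)
    (trans (sym (code≡⟨tag,body⟩ p)) (trans eq (code≡⟨tag,body⟩ q)))

mutual
  code-injective : ∀ {n} (p q : Prog n) → code p ≡ code q → p ≡ q
  code-injective p q eq = tag-body-injective p q (code-inversion p q eq)

  tag-body-injective : ∀ {n} (p q : Prog n) → tag p ≡ tag q × body p ≡ body q → p ≡ q
  tag-body-injective zer         zer           _        = refl
  tag-body-injective succ        succ          _        = refl
  tag-body-injective (proj i)    (proj j)      (_ , eq) = cong proj (Fin.toℕ-injective eq)
  tag-body-injective (comp f gs) (comp f′ gs′) (_ , eq) =
    comp-injective f gs f′ gs′ (⟨,⟩-injective (code f) (codes gs) (code f′) (codes gs′) eq)
  tag-body-injective (prec g h)  (prec g′ h′)  (_ , eq) =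
    prec-injective g h g′ h′ (⟨,⟩-injective (code g) (code h) (code g′) (code h′) eq)
  tag-body-injective (mu f)      (mu f′)       (_ , eq) = cong mu (code-injective f f′ eq)
  tag-body-injective oracle      oracle        _        = refl

  -- The arity of the outer program is recovered from the length of the coded vector of inner
  -- programs; only then do the two outer programs have the same type.
  comp-injective : ∀ {k l n} (f : Prog k) (gs : Vec (Prog n) k) (f′ : Prog l) (gs′ : Vec (Prog n) l) →
                   code f ≡ code f′ × codes gs ≡ codes gs′ → comp f gs ≡ comp f′ gs′
  comp-injective f gs f′ gs′ (eqf , eqgs) with codes-injective gs gs′ eqgs
  ... | refl = cong (λ f → comp f gs) (code-injective f f′ eqf)

  prec-injective : ∀ {n} (g : Prog n) h (g′ : Prog n) h′ →
                   code g ≡ code g′ × code h ≡ code h′ → prec g h ≡ prec g′ h′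
  prec-injective g h g′ h′ (eqg , eqh) = cong₂ prec (code-injective g g′ eqg) (code-injective h h′ eqh)

  codes-injective : ∀ {k l n} (ps : Vec (Prog n) k) (qs : Vec (Prog n) l) → codes ps ≡ codes qs →
                    (k , ps) ≡ (l , qs)
  codes-injective []       []       _  = refl
  codes-injective []       (q ∷ qs) eq = contradiction eq (0≢⟨,⟩ (code q) (codes qs))
  codes-injective (p ∷ ps) []       eq = contradiction (sym eq) (0≢⟨,⟩ (code p) (codes ps))
  codes-injective (p ∷ ps) (q ∷ qs) eq =
    codes-∷-injective p ps q qs (⟨,⟩-injective (code p) (codes ps) (code q) (codes qs) eq)

  codes-∷-injective : ∀ {k l n} (p : Prog n) (ps : Vec (Prog n) k) (q : Prog n) (qs : Vec (Prog n) l) →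
                      code p ≡ code q × codes ps ≡ codes qs → (suc k , p ∷ ps) ≡ (suc l , q ∷ qs)
  codes-∷-injective p ps q qs (eqp , eqps) with code-injective p q eqp | codes-injective ps qs eqps
  ... | refl | refl = refl

-- Shaped like the premises of `mu`. It also serves to find the least tuple that is never refuted.
least-zero : ∀ (f : ℕ → ℕ) c → f c ≡ 0 → ∃[ m ] (f m ≡ 0 × (∀ z → z < m → ∃[ v ] f z ≡ suc v))
least-zero f c fc≡0 with f 0 in f0
... | zero = 0 , f0 , λ _ ()
least-zero f zero    fc≡0 | suc v = contradiction (trans (sym f0) fc≡0) λ ()
least-zero f (suc c) fc≡0 | suc v with least-zero (f ∘ suc) c fc≡0
... | m , fm≡0 , below = suc m , fm≡0 , below′
  where
  below′ : ∀ z → z < suc m → ∃[ v ] f z ≡ suc v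
  below′ zero    _         = v , f0
  below′ (suc z) (s≤s z<m) = below z z<m

-- By injectivity of the pairing and of `code`, the program and the input that witness membership in
-- `∅′` must be `q` and `u`.
∈∅′⇔halts : ∀ (q : Prog 1) u → ⟨ code q , u ⟩ ∈ ∅′ ⇔ (∃[ y ] ∅ ⊢ q [ u ∷ [] ]↓ y)
∈∅′⇔halts q u = mk⇔ to (λ (y , halt) → q , u , y , refl , halt)
  where
  transport : ∀ {p x y} → code q ≡ code {1} p × u ≡ x → ∅ ⊢ p [ x ∷ [] ]↓ y → ∅ ⊢ q [ u ∷ [] ]↓ y
  transport {p} (eq , refl) halt = subst (∅ ⊢_[ u ∷ [] ]↓ _) (sym (code-injective q p eq)) halt

  to : ⟨ code q , u ⟩ ∈ ∅′ → ∃[ y ] ∅ ⊢ q [ u ∷ [] ]↓ y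
  to (p , x , y , eq , halt) = y , transport (⟨,⟩-injective (code q) u (code p) x eq) halt

-- As `f` is total, the unbounded search gets stuck at no candidate; so a Σ₁ condition becomes a
-- halting condition.
mu-halts⇔ : ∀ {f : Vec ℕ 2 → ℕ} (f′ : Recursive ∅ f) u →
            (∃[ y ] ∅ ⊢ mu (program f′) [ u ∷ [] ]↓ y) ⇔ (∃[ c ] f (c ∷ u ∷ []) ≡ 0)
mu-halts⇔ {f} f′ u = mk⇔ to from
  where
  to : ∃[ y ] ∅ ⊢ mu (program f′) [ u ∷ [] ]↓ y → ∃[ c ] f (c ∷ u ∷ []) ≡ 0
  to (y , mu halt _) = y , ↓-deterministic (halts f′ (y ∷ u ∷ [])) halt

  from : ∃[ c ] f (c ∷ u ∷ []) ≡ 0 → ∃[ y ] ∅ ⊢ mu (program f′) [ u ∷ [] ]↓ y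
  from (c , fc≡0) with least-zero (λ c → f (c ∷ u ∷ [])) c fc≡0
  ... | m , fm≡0 , below =
    m , mu (subst (∅ ⊢ program f′ [ m ∷ u ∷ [] ]↓_) fm≡0 (halts f′ (m ∷ u ∷ [])))
           (λ z z<m → proj₁ (below z z<m) ,
              subst (∅ ⊢ program f′ [ z ∷ u ∷ [] ]↓_) (proj₂ (below z z<m)) (halts f′ (z ∷ u ∷ [])))

indicator : ∀ {P : Set} → Dec P → ℕ
indicator (yesᵈ _) = 1
indicator (noᵈ _)  = 0

indicator-yes : ∀ {P : Set} (P? : Dec P) → P → indicator P? ≡ 1
indicator-yes (yesᵈ _) _ = refl
indicator-yes (noᵈ ¬p) p = contradiction p ¬p

indicator-no : ∀ {P : Set} (P? : Dec P) → ¬ P → indicator P? ≡ 0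
indicator-no (yesᵈ p) ¬p = contradiction p ¬p
indicator-no (noᵈ _)  _  = refl

1∸indicator≡0 : ∀ {P : Set} (P? : Dec P) → 1 ∸ indicator P? ≡ 0 → P
1∸indicator≡0 (yesᵈ p) _ = p

module _ (em : ExcludedMiddle 0ℓ) {O : Pred ℕ 0ℓ} {n} {f : Vec ℕ n → ℕ} where

  -- Excluded middle makes the characteristic function total, and the reduction computes it in
  -- either case.
  ≤T-recursive : ∀ {P : Pred ℕ 0ℓ} → P ≤T O → Recursive O f →
                 Recursive O (λ xs → indicator (em {P (f xs)}))
  ≤T-recursive {P} (p , decides) f′ = comp p (program f′ ∷ []) computes λ xs → comp (halts f′ xs ∷ []) (run xs)
    where
    run : ∀ xs → O ⊢ p [ f xs ∷ [] ]↓ indicator (em {P (f xs)})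
    run xs with em {P (f xs)}
    ... | yesᵈ x∈P = proj₁ (decides (f xs)) x∈P
    ... | noᵈ x∉P  = proj₂ (decides (f xs)) x∉P

  oracleʳ : Recursive O f → Recursive O (λ xs → indicator (em {O (f xs)}))
  oracleʳ = ≤T-recursive (oracle , λ _ → yes , no)

-- Atomic diagrams and restrictions

odd-suc : ∀ d → odd d ≡ 0 → odd (suc d) ≡ 1
odd-suc zero          _  = refl
odd-suc (suc (suc d)) eq = odd-suc d eq

⌊suc/2⌋ : ∀ d → odd d ≡ 0 → ⌊ suc d /2⌋ ≡ ⌊ d /2⌋
⌊suc/2⌋ zero          _  = refl
⌊suc/2⌋ (suc (suc d)) eq = cong suc (⌊suc/2⌋ d eq)

-- Adding `2 ^ c` causes no carry when digit `c` is 0.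
bit-2^+-≡ : ∀ c d → bit c d ≡ 0 → bit c (2 ^ c + d) ≡ 1
bit-2^+-≡ zero    d eq = odd-suc d eq
bit-2^+-≡ (suc c) d eq =
  trans (bit-suc c (2 ^ suc c + d))
    (trans (cong (bit c) (⌊2*+/2⌋ (2 ^ c) d))
      (bit-2^+-≡ c ⌊ d /2⌋ (trans (sym (bit-suc c d)) eq)))

bit-2^+-≢ : ∀ c d {e} → bit c d ≡ 0 → e ≢ c → bit e (2 ^ c + d) ≡ bit e d
bit-2^+-≢ zero    d {zero}  eq e≢c = contradiction refl e≢c
bit-2^+-≢ zero    d {suc e} eq e≢c =
  trans (bit-suc e (1 + d)) (trans (cong (bit e) (⌊suc/2⌋ d eq)) (sym (bit-suc e d)))
bit-2^+-≢ (suc c) d {zero}  eq e≢c = odd-2*+ (2 ^ c) d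
bit-2^+-≢ (suc c) d {suc e} eq e≢c = begin
  bit (suc e) (2 ^ suc c + d)  ≡⟨ bit-suc e (2 ^ suc c + d) ⟩
  bit e ⌊ 2 ^ suc c + d /2⌋    ≡⟨ cong (bit e) (⌊2*+/2⌋ (2 ^ c) d) ⟩
  bit e (2 ^ c + ⌊ d /2⌋)      ≡⟨ bit-2^+-≢ c ⌊ d /2⌋ (trans (sym (bit-suc c d)) eq) (e≢c ∘ cong suc) ⟩
  bit e ⌊ d /2⌋                ≡⟨ bit-suc e d ⟨
  bit (suc e) d                ∎
  where open ≡-Reasoning

bit-0 : ∀ e → bit e 0 ≡ 0
bit-0 zero    = refl
bit-0 (suc e) = trans (bit-suc e 0) (bit-0 e)

mutual
  bit-canonicalIndex-∉ : ∀ {cs e} → Unique cs → e ∉ˡ cs → bit e (canonicalIndex cs) ≡ 0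
  bit-canonicalIndex-∉ {[]}     {e} _ _ = bit-0 e
  bit-canonicalIndex-∉ {c ∷ cs}     u@(_ ∷ uniq) e∉ =
    trans (bit-2^+-≢ c (canonicalIndex cs) (head-bit u) (e∉ ∘ here))
          (bit-canonicalIndex-∉ uniq (e∉ ∘ there))

  -- Absence of repetitions is what keeps the sum of powers of two free of carries.
  head-bit : ∀ {c cs} → Unique (c ∷ cs) → bit c (canonicalIndex cs) ≡ 0
  head-bit (c≢ ∷ uniq) = bit-canonicalIndex-∉ uniq λ c∈ → All.lookup c≢ c∈ refl

bit-canonicalIndex-∈ : ∀ {cs e} → Unique cs → e ∈ˡ cs → bit e (canonicalIndex cs) ≡ 1
bit-canonicalIndex-∈ {c ∷ cs} u (here refl) = bit-2^+-≡ c (canonicalIndex cs) (head-bit u)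
bit-canonicalIndex-∈ {c ∷ cs} u@(c≢ ∷ uniq) (there e∈) =
  trans (bit-2^+-≢ c (canonicalIndex cs) (head-bit u) (λ e≡c → All.lookup c≢ e∈ (sym e≡c)))
        (bit-canonicalIndex-∈ uniq e∈)

symbolNumber-injective : ∀ σ {r r′} → symbolNumber σ r ≡ symbolNumber σ r′ → r ≡ r′
symbolNumber-injective (finite _ _) = Fin.toℕ-injective
symbolNumber-injective (infinite _) = λ eq → eq

gödel-injective : ∀ {σ} {a b : Atom σ} → gödel a ≡ gödel b → a ≡ b
gödel-injective {σ} {r , xs} {r′ , ys} eq =
  go (⟨,⟩-injective (symbolNumber σ r) (codeSeq xs) (symbolNumber σ r′) (codeSeq ys) eq)
  where
  go : symbolNumber σ r ≡ symbolNumber σ r′ × codeSeq xs ≡ codeSeq ys → (r , xs) ≡ (r′ , ys)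
  go (eqr , eqs) with symbolNumber-injective σ eqr
  ... | refl with codeSeq-injective xs ys eqs
  ... | refl = refl

tuples-unique : ∀ n k → Unique (tuples n k)
tuples-unique n zero    = [] ∷ []
tuples-unique n (suc k) =
  Unique.cartesianProductWith⁺ _∷_ ∷-injective (Unique.upTo⁺ (suc n)) (tuples-unique n k)

visible-unique : ∀ σ n → Unique (visible σ n)
visible-unique (finite k _) n = Unique.allFin⁺ k
visible-unique (infinite _) n = Unique.upTo⁺ (suc n)

atoms-unique : ∀ σ n → Unique (atoms σ n)
atoms-unique σ n =
  Unique.concat⁺
    (All.map⁺ (All.tabulate λ _ → Unique.map⁺ (λ { refl → refl }) (tuples-unique n _)))
    (AllPairs.map⁺ (AllPairs.map disjoint (visible-unique σ n)))
  where
  disjoint : ∀ {r r′} → r ≢ r′ → ∀ {a} →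
             ¬ (a ∈ˡ List.map (r ,_) (tuples n (arity σ r)) ×
                a ∈ˡ List.map (r′ ,_) (tuples n (arity σ r′)))
  disjoint r≢r′ (a∈ , a∈′) with ∈-map⁻ _ a∈ | ∈-map⁻ _ a∈′
  ... | _ , _ , refl | _ , _ , refl = r≢r′ refl

∈-visible : ∀ σ {n r} → symbolNumber σ r ≤ n → r ∈ˡ visible σ n
∈-visible (finite _ _) {r = r} _   = ∈-allFin r
∈-visible (infinite _) {r = r} r≤n = ∈-upTo⁺ (s≤s r≤n)

-- A code exceeds every entry of its sequence.
∈-tuples : ∀ {n k} {xs : Vec ℕ k} → codeSeq xs ≤ n → xs ∈ˡ tuples n k
∈-tuples {xs = []}     _  = here refl
∈-tuples {xs = x ∷ xs} ≤n =
  ∈-cartesianProductWith⁺ _∷_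
    (∈-upTo⁺ (≤-trans (m<⟨m,n⟩ x (codeSeq xs)) (m≤n⇒m≤1+n ≤n)))
    (∈-tuples (≤-trans (<⇒≤ (n<⟨m,n⟩ x (codeSeq xs))) ≤n))

map-cong-tuples : ∀ {f g : ℕ → ℕ} {n k} {xs : Vec ℕ k} → (∀ x → x ≤ n → f x ≡ g x) →
                  xs ∈ˡ tuples n k → Vec.map f xs ≡ Vec.map g xs
map-cong-tuples {xs = []}             eq _  = refl
map-cong-tuples {n = n} {xs = x ∷ xs} eq xs∈
  with ∈-cartesianProductWith⁻ _∷_ (upTo (suc n)) (tuples n _) xs∈
... | _ , _ , x∈ , xs′∈ , refl =
  cong₂ _∷_ (eq x (≤-pred (∈-upTo⁻ x∈))) (map-cong-tuples eq xs′∈)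

module _ {σ : Signature} where

  ∈-atoms⁺ : ∀ {n r xs} → symbolNumber σ r ≤ n → codeSeq xs ≤ n → (r , xs) ∈ˡ atoms σ n
  ∈-atoms⁺ {n} r≤n xs≤n =
    ∈-concatMap⁺ (λ r → List.map (r ,_) (tuples n (arity σ r)))
      (lose (∈-visible σ r≤n) (∈-map⁺ _ (∈-tuples xs≤n)))

  ∈-atoms⁻ : ∀ {n r xs} → (r , xs) ∈ˡ atoms σ n → xs ∈ˡ tuples n (arity σ r)
  ∈-atoms⁻ {n} a∈ with find (∈-concatMap⁻ (λ r → List.map (r ,_) (tuples n (arity σ r))) {xs = visible σ n} a∈)
  ... | _ , _ , a∈′ with ∈-map⁻ _ a∈′
  ... | _ , xs∈ , refl = xs∈

  index : Structure σ → ℕ → ℕ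
  index S n = canonicalIndex (List.map gödel (proj₂ (S ↾ n)))

  gödel∈atomicDiagram⇒holds : ∀ {S : Structure σ} {a} → gödel a ∈ atomicDiagram S → T (holds S a)
  gödel∈atomicDiagram⇒holds {S} (b , eq , Tb) = subst (T ∘ holds S) (gödel-injective eq) Tb

  -- This is how atomic facts are read off the learner's input: stage `n` lists every true atom
  -- whose symbol number and tuple code are at most `n`. If `⟨ r , s ⟩` codes no atom, both sides
  -- are 0.
  bit-index : ∀ {S : Structure σ} {n r s} → r ≤ n → s ≤ n →
              (P? : Dec (⟨ r , s ⟩ ∈ atomicDiagram S)) → bit ⟨ r , s ⟩ (index S n) ≡ indicator P?
  bit-index {S} {n} {r} {s} r≤n s≤n (yesᵈ ((r′ , xs) , eq , Ta)) =
    bit-canonicalIndex-∈ unique (subst (_∈ˡ List.map gödel (proj₂ (S ↾ n))) eq (∈-map⁺ gödel a∈))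
    where
    unique = Unique.map⁺ gödel-injective (Unique.filter⁺ (T? ∘ holds S) (atoms-unique σ n))
    eqs = ⟨,⟩-injective (symbolNumber σ r′) (codeSeq xs) r s eq
    a∈ = ∈-filter⁺ (T? ∘ holds S)
           (∈-atoms⁺ (subst (_≤ n) (sym (proj₁ eqs)) r≤n) (subst (_≤ n) (sym (proj₂ eqs)) s≤n)) Ta
  bit-index {S} {n} r≤n s≤n (noᵈ ∉diagram) =
    bit-canonicalIndex-∉ unique λ e∈ → ∉diagram (found (∈-map⁻ gödel e∈))
    where
    unique = Unique.map⁺ gödel-injective (Unique.filter⁺ (T? ∘ holds S) (atoms-unique σ n))
    found : ∀ {e} → ∃[ a ] (a ∈ˡ proj₂ (S ↾ n) × e ≡ gödel a) → e ∈ atomicDiagram S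
    found (a , a∈ , eq) = a , sym eq , proj₂ (∈-filter⁻ (T? ∘ holds S) {xs = atoms σ n} a∈)

  ↾-cong : ∀ {S S′ : Structure σ} {n} → (∀ a → a ∈ˡ atoms σ n → holds S a ≡ holds S′ a) → S ↾ n ≡ S′ ↾ n
  ↾-cong {S} {S′} {n} eq = cong (n ,_) (filter-cong (atoms σ n) eq)
    where
    filter-cong : ∀ as → (∀ a → a ∈ˡ as → holds S a ≡ holds S′ a) →
                  filterᵇ (holds S) as ≡ filterᵇ (holds S′) as
    filter-cong []       eq = refl
    filter-cong (a ∷ as) eq with holds S a | holds S′ a | eq a (here refl)
    ... | true  | _ | refl = cong (a ∷_) (filter-cong as (λ b b∈ → eq b (there b∈)))
    ... | false | _ | refl = filter-cong as (λ b b∈ → eq b (there b∈))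

  pullback : Structure σ → (ℕ → ℕ) → Structure σ
  pullback A f r xs = A r (Vec.map f xs)

  pullback-↾-cong : ∀ {A : Structure σ} {f g n} → (∀ x → x ≤ n → f x ≡ g x) →
                    pullback A f ↾ n ≡ pullback A g ↾ n
  pullback-↾-cong {A} eq = ↾-cong λ { (r , xs) a∈ → cong (A r) (map-cong-tuples eq (∈-atoms⁻ a∈)) }

-- Locking

open Inverse using (to; from; strictlyInverseˡ; strictlyInverseʳ)

transpose : ℕ → ℕ → ℕ → ℕ
transpose a b x with x ≟ a
... | yesᵈ _ = b
... | noᵈ _ with x ≟ b
... | yesᵈ _ = a
... | noᵈ _  = x

transpose-l : ∀ a b → transpose a b a ≡ b
transpose-l a b with a ≟ a
... | yesᵈ _  = refl
... | noᵈ a≢a = contradiction refl a≢a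

transpose-r : ∀ a b → transpose a b b ≡ a
transpose-r a b with b ≟ a
... | yesᵈ b≡a = b≡a
... | noᵈ _ with b ≟ b
... | yesᵈ _  = refl
... | noᵈ b≢b = contradiction refl b≢b

transpose-other : ∀ {a b x} → x ≢ a → x ≢ b → transpose a b x ≡ x
transpose-other {a} {b} {x} x≢a x≢b with x ≟ a
... | yesᵈ x≡a = contradiction x≡a x≢a
... | noᵈ _ with x ≟ b
... | yesᵈ x≡b = contradiction x≡b x≢b
... | noᵈ _    = refl

transpose-involutive : ∀ a b x → transpose a b (transpose a b x) ≡ x
transpose-involutive a b x with x ≟ a
... | yesᵈ refl = transpose-r a b
... | noᵈ x≢a with x ≟ b
... | yesᵈ refl = transpose-l a b
... | noᵈ x≢b   = transpose-other x≢a x≢b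

transposition : ℕ → ℕ → ℕ ↔ ℕ
transposition a b = mk↔ₛ′ (transpose a b) (transpose a b) (transpose-involutive a b) (transpose-involutive a b)

to-injective : ∀ (g : ℕ ↔ ℕ) {x y} → to g x ≡ to g y → x ≡ y
to-injective g {x} {y} eq =
  trans (sym (strictlyInverseʳ g x)) (trans (cong (from g) eq) (strictlyInverseʳ g y))

-- Induction on `n`: swapping the value taken at `n` with the desired `f n` corrects that argument,
-- and injectivity of `g` and `f` keeps the earlier values fixed.
extend-injection : ∀ (f : ℕ → ℕ) n → (∀ x y → x < n → y < n → f x ≡ f y → x ≡ y) →
                   Σ (ℕ ↔ ℕ) λ g → ∀ x → x < n → to g x ≡ f x
extend-injection f zero    inj = ↔-id ℕ , λ _ ()
extend-injection f (suc n) inj with extend-injection f n (λ x y x<n y<n → inj x y (m<n⇒m<1+n x<n) (m<n⇒m<1+n y<n))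
... | g , g≗f = transposition (to g n) (f n) ↔-∘ g , agree
  where
  agree : ∀ x → x < suc n → transpose (to g n) (f n) (to g x) ≡ f x
  agree x x<1+n with x ≟ n
  ... | yesᵈ refl = transpose-l (to g n) (f n)
  ... | noᵈ x≢n   = trans (transpose-other (x≢n ∘ to-injective g) gx≢fn) (g≗f x x<n)
    where
    x<n : x < n
    x<n = ≤∧≢⇒< (≤-pred x<1+n) x≢n
    gx≢fn : to g x ≢ f n
    gx≢fn eq = x≢n (inj x n x<1+n (n<1+n n) (trans (sym (g≗f x x<n)) eq))

module _ (em : ExcludedMiddle 0ℓ) {σ : Signature} {H : Set} (A : Structure σ) (M : FinStr σ → H) (h : H) where

  private
    outputs : (ℕ ↔ ℕ) → ℕ → H
    outputs g n = M (pullback A (to g) ↾ n)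

  -- The pair `g`, `L` stands for a finite partial enumeration: only the values of `g` below `L`
  -- count.
  Locks : (ℕ ↔ ℕ) → ℕ → Set
  Locks g L = ∀ g′ → (∀ x → x < L → to g′ x ≡ to g x) → ∀ n → L ≤ n → outputs g′ n ≡ h

  private
    Escape : (ℕ ↔ ℕ) → ℕ → Set
    Escape g L = Σ (ℕ ↔ ℕ) λ g′ → (∀ x → x < L → to g′ x ≡ to g x) × ∃[ n ] (L ≤ n × outputs g′ n ≢ h)

    -- Without a locking pair, the escapes can be iterated; the successive bijections
    -- converge to a bijection on which M errs infinitely often.
    module Limit (escape : ∀ g L → Escape g L) where

      mutual
        g : ℕ → ℕ ↔ ℕ
        g zero    = ↔-id ℕ
        g (suc s) = proj₁ (escape (g s) (L s))

        L : ℕ → ℕ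
        L zero    = zero
        -- Exceeding the stage of the error preserves that error in the limit; exceeding the
        -- preimage of `s` puts `s` into the range of the limit.
        L (suc s) = suc (proj₁ (proj₂ (proj₂ (escape (g s) (L s)))) + from (g (suc s)) s)

      e : ℕ → ℕ
      e s = proj₁ (proj₂ (proj₂ (escape (g s) (L s))))

      L≤e : ∀ s → L s ≤ e s
      L≤e s = proj₁ (proj₂ (proj₂ (proj₂ (escape (g s) (L s)))))

      e<L : ∀ s → e s < L (suc s)
      e<L s = s≤s (m≤m+n (e s) (from (g (suc s)) s))

      from<L : ∀ s → from (g (suc s)) s < L (suc s)
      from<L s = s≤s (m≤n+m (from (g (suc s)) s) (e s))

      L-suc : ∀ s → L s < L (suc s)
      L-suc s = ≤-<-trans (L≤e s) (e<L s)

      n≤L : ∀ s → s ≤ L s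
      n≤L zero    = z≤n
      n≤L (suc s) = ≤-<-trans (n≤L s) (L-suc s)

      stable-+ : ∀ k {s x} → x < L s → x < L (k + s) × to (g (k + s)) x ≡ to (g s) x
      stable-+ zero        x<L = x<L , refl
      stable-+ (suc k) {s} x<L with stable-+ k x<L
      ... | x<L′ , eq =
        <-trans x<L′ (L-suc (k + s)) , trans (proj₁ (proj₂ (escape (g (k + s)) (L (k + s)))) _ x<L′) eq

      stable : ∀ {s t x} → s ≤ t → x < L s → to (g t) x ≡ to (g s) x
      stable {s} {t} {x} s≤t x<L =
        subst (λ t → to (g t) x ≡ to (g s) x) (m∸n+n≡m s≤t) (proj₂ (stable-+ (t ∸ s) x<L))

      -- By `n≤L`, `x` lies below `L (suc x)`, so its value is final from `g (suc x)` on.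
      limit : ℕ → ℕ
      limit x = to (g (suc x)) x

      limit⁻¹ : ℕ → ℕ
      limit⁻¹ y = from (g (suc y)) y

      limit-g : ∀ {s x} → x < L s → limit x ≡ to (g s) x
      limit-g {s} {x} x<L =
        trans (sym (stable (m≤m⊔n (suc x) s) (n≤L (suc x)))) (stable (m≤n⊔m (suc x) s) x<L)

      limit-limit⁻¹ : ∀ y → limit (limit⁻¹ y) ≡ y
      limit-limit⁻¹ y = trans (limit-g (from<L y)) (strictlyInverseˡ (g (suc y)) y)

      limit⁻¹-limit : ∀ x → limit⁻¹ (limit x) ≡ x
      limit⁻¹-limit x = to-injective (g t) (begin
        to (g t) (limit⁻¹ y)        ≡⟨ stable (m≤m⊔n (suc y) (suc x)) (from<L y) ⟩
        to (g (suc y)) (limit⁻¹ y)  ≡⟨ strictlyInverseˡ (g (suc y)) y ⟩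
        y                           ≡⟨ stable (m≤n⊔m (suc y) (suc x)) (n≤L (suc x)) ⟨
        to (g t) x                  ∎)
        where
        open ≡-Reasoning
        y = limit x
        t = suc y ⊔ suc x

      limit-↔ : ℕ ↔ ℕ
      limit-↔ = mk↔ₛ′ limit limit⁻¹ limit-limit⁻¹ limit⁻¹-limit

      errs : ∀ s → outputs limit-↔ (e s) ≢ h
      errs s eq = proj₂ (proj₂ (proj₂ (proj₂ (escape (g s) (L s)))))
        (trans (cong M (pullback-↾-cong {A = A} λ x x≤e → sym (limit-g (≤-<-trans x≤e (e<L s))))) eq)

  -- The limit of the escapes is itself an enumeration of `A`. From some stage `N` on `M` should be
  -- right on it, yet it errs at `e N`, which is at least `N`.
  locking-pair : (∀ g → ∃[ N ] ∀ n → N ≤ n → outputs g n ≡ h) → Σ (ℕ ↔ ℕ) λ g → ∃[ L ] Locks g L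
  locking-pair converges = decidable-stable em λ ¬locked →
    let open Limit (λ g L → decidable-stable em λ ¬escape →
              ¬locked (g , L , λ g′ g′≗g n L≤n → decidable-stable em λ ≢h →
                ¬escape (g′ , g′≗g , n , L≤n , ≢h)))
        N , correct = converges limit-↔
    in errs N (correct (e N) (≤-trans (n≤L N) (L≤e N)))

-- The embedding test

indicator-cong : ∀ {P Q : Set} → P ⇔ Q → (P? : Dec P) (Q? : Dec Q) → indicator P? ≡ indicator Q?
indicator-cong P⇔Q (yesᵈ p) Q? = sym (indicator-yes Q? (Equivalence.to P⇔Q p))
indicator-cong P⇔Q (noᵈ ¬p) Q? = sym (indicator-no Q? (¬p ∘ Equivalence.from P⇔Q))

distance : ℕ → ℕ → ℕ
distance x y = (x ∸ y) + (y ∸ x)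

distance≡0⇒≡ : ∀ {x y} → distance x y ≡ 0 → x ≡ y
distance≡0⇒≡ {x} {y} eq =
  ≤-antisym (m∸n≡0⇒m≤n (m+n≡0⇒m≡0 (x ∸ y) eq)) (m∸n≡0⇒m≤n (m+n≡0⇒n≡0 (x ∸ y) eq))

≡⇒distance≡0 : ∀ {x y} → x ≡ y → distance x y ≡ 0
≡⇒distance≡0 {x} refl = cong₂ _+_ (n∸n≡0 x) (n∸n≡0 x)

sumBelow≡0⇒ : ∀ {n f} → sumBelow n f ≡ 0 → ∀ i → i < n → f i ≡ 0
sumBelow≡0⇒ {suc n} {f} eq i i<1+n with i ≟ n
... | yesᵈ refl = m+n≡0⇒m≡0 (f i) eq
... | noᵈ i≢n   = sumBelow≡0⇒ {n} (m+n≡0⇒n≡0 (f n) eq) i (≤∧≢⇒< (≤-pred i<1+n) i≢n)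

⇒sumBelow≡0 : ∀ {n f} → (∀ i → i < n → f i ≡ 0) → sumBelow n f ≡ 0
⇒sumBelow≡0 {zero}  _  = refl
⇒sumBelow≡0 {suc n} eq =
  cong₂ _+_ (eq n (n<1+n n)) (⇒sumBelow≡0 {n} λ i i<n → eq i (m<n⇒m<1+n i<n))

distanceʳ : ∀ {O n} {f g : Vec ℕ n → ℕ} → Recursive O f → Recursive O g →
            Recursive O (λ xs → distance (f xs) (g xs))
distanceʳ f g = (f ∸ʳ g) +ʳ (g ∸ʳ f)

module _ (em : ExcludedMiddle 0ℓ) where

  χ : Pred ℕ 0ℓ → ℕ → ℕ
  χ P x = indicator (em {P x})

  -- c codes an embedding into A of the structure on {0,…,n} with canonical index d, as far as
  -- the atoms ⟨ r , s ⟩ with r , s < n can tell, that maps the tuple coded by t to the one coded by a.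
  record Embeds {σ} (A : Structure σ) (L a t n d c : ℕ) : Set where
    field
      distinct : ∀ x y → x < n → y < n → nth c x ≡ nth c y → x ≡ y
      base     : ∀ l → l < L → nth c (nth t l) ≡ nth a l
      faithful : ∀ r s → r < n → s < n → bit ⟨ r , s ⟩ d ≡ χ (atomicDiagram A) ⟨ r , mapSeq c s ⟩

  module _ {σ} (A : Structure σ) (L a : ℕ) where

    -- Positive exactly when `x` and `y` are distinct with equal images.
    collision : ℕ → ℕ → ℕ → ℕ
    collision c x y = (1 ∸ distance (nth c x) (nth c y)) * distance x y

    error : ℕ → ℕ → ℕ → ℕ → ℕ
    error t n d c =
      sumBelow n (λ x → sumBelow n λ y → collision c x y) +
      (sumBelow L (λ l → distance (nth c (nth t l)) (nth a l)) +
       sumBelow n (λ r → sumBelow n λ s → distance (bit ⟨ r , s ⟩ d) (χ (atomicDiagram A) ⟨ r , mapSeq c s ⟩)))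

    collision≡0⇒ : ∀ c {x y} → collision c x y ≡ 0 → nth c x ≡ nth c y → x ≡ y
    collision≡0⇒ c {x} {y} eq cx≡cy = distance≡0⇒≡ (trans (sym (*-identityˡ (distance x y)))
      (trans (cong (λ z → (1 ∸ z) * distance x y) (sym (≡⇒distance≡0 cx≡cy))) eq))

    ⇒collision≡0 : ∀ c {x y} → (nth c x ≡ nth c y → x ≡ y) → collision c x y ≡ 0
    ⇒collision≡0 c {x} {y} inj with distance (nth c x) (nth c y) in eq
    ... | zero  = trans (*-identityˡ (distance x y)) (≡⇒distance≡0 (inj (distance≡0⇒≡ eq)))
    ... | suc z = cong (_* distance x y) (0∸n≡0 z)

    error≡0⇔ : ∀ {t n d c} → error t n d c ≡ 0 ⇔ Embeds A L a t n d c
    error≡0⇔ {t} {n} {d} {c} = mk⇔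
      (λ eq → let eq₁ = m+n≡0⇒m≡0 E₁ eq
                  eq₂ = m+n≡0⇒m≡0 E₂ (m+n≡0⇒n≡0 E₁ eq)
                  eq₃ = m+n≡0⇒n≡0 E₂ (m+n≡0⇒n≡0 E₁ eq) in record
        { distinct = λ x y x<n y<n → collision≡0⇒ c (sumBelow≡0⇒ {n} (sumBelow≡0⇒ {n} eq₁ x x<n) y y<n)
        ; base     = λ l l<L → distance≡0⇒≡ (sumBelow≡0⇒ {L} eq₂ l l<L)
        ; faithful = λ r s r<n s<n → distance≡0⇒≡ (sumBelow≡0⇒ {n} (sumBelow≡0⇒ {n} eq₃ r r<n) s s<n)
        })
      (λ embeds → let open Embeds embeds in
        cong₂ _+_ (⇒sumBelow≡0 {n} λ x x<n → ⇒sumBelow≡0 {n} λ y y<n → ⇒collision≡0 c (distinct x y x<n y<n))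
          (cong₂ _+_ (⇒sumBelow≡0 {L} λ l l<L → ≡⇒distance≡0 (base l l<L))
                     (⇒sumBelow≡0 {n} λ r r<n → ⇒sumBelow≡0 {n} λ s s<n → ≡⇒distance≡0 (faithful r s r<n s<n))))
      where
      E₁ = sumBelow n (λ x → sumBelow n λ y → collision c x y)
      E₂ = sumBelow L (λ l → distance (nth c (nth t l)) (nth a l))

    -- Only bounded sums occur, and `A` enters only through the decision procedure for its atomic
    -- diagram.
    errorʳ : ∀ {O m} {t n d c : Vec ℕ m → ℕ} → atomicDiagram A ≤T O →
             Recursive O t → Recursive O n → Recursive O d → Recursive O c →
             Recursive O (λ xs → error (t xs) (n xs) (d xs) (c xs))
    errorʳ computable t n d c =
      sumʳ n (sumʳ (weaken n)
        ((lit 1 ∸ʳ distanceʳ (nthʳ (weaken (weaken c)) (var (suc zero))) (nthʳ (weaken (weaken c)) (var zero)))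
         *ʳ distanceʳ (var (suc zero)) (var zero))) +ʳ
      (sumʳ (lit L) (distanceʳ (nthʳ (weaken c) (nthʳ (weaken t) (var zero))) (nthʳ (lit a) (var zero))) +ʳ
       sumʳ n (sumʳ (weaken n)
         (distanceʳ (bitʳ ⟨ var (suc zero) , var zero ⟩ʳ (weaken (weaken d)))
                    (≤T-recursive em computable ⟨ var (suc zero) , mapSeqʳ (weaken (weaken c)) (var zero) ⟩ʳ))))

  haltsʳ : ∀ {m} {u : Vec ℕ m → ℕ} (q : Prog 1) → Recursive ∅′ u →
           Recursive ∅′ (λ xs → χ (λ u → ∃[ y ] ∅ ⊢ q [ u ∷ [] ]↓ y) (u xs))
  haltsʳ {u = u} q u′ = ext (λ xs → indicator-cong (∈∅′⇔halts q (u xs)) em em) (oracleʳ em ⟨ lit (code q) , u′ ⟩ʳ)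

  -- The matrix `f` is computable without oracle because `∅′` answers questions about oracle-free
  -- computations; the argument `u` may itself be computed from `∅′`.
  Σ₁ʳ : ∀ {m} {f : Vec ℕ 2 → ℕ} {u : Vec ℕ m → ℕ} → Recursive ∅ f → Recursive ∅′ u →
        Recursive ∅′ (λ xs → indicator (em {∃[ c ] f (c ∷ u xs ∷ []) ≡ 0}))
  Σ₁ʳ {u = u} f′ u′ =
    ext (λ xs → indicator-cong (mu-halts⇔ f′ (u xs)) em em) (haltsʳ (mu (program f′)) u′)

  -- The parameters `t`, `n` and `d` are packed into one number because `∅′` speaks of unary
  -- programs.
  decodedError : ∀ {σ} (A : Structure σ) (L a : ℕ) → Vec ℕ 2 → ℕ
  decodedError A L a (c ∷ u ∷ []) = error A L a (head u) (head (tail u)) (tail (tail u)) c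

  decodedErrorʳ : ∀ {σ} {A : Structure σ} {L a} → Computable A → Recursive ∅ (decodedError A L a)
  decodedErrorʳ {A = A} {L} {a} computable =
    ext (λ { (_ ∷ _ ∷ []) → refl })
        (errorʳ A L a computable (headʳ (var (suc zero))) (headʳ (tailʳ (var (suc zero))))
                (tailʳ (tailʳ (var (suc zero)))) (var zero))

  decodedError-⟨,⟩ : ∀ {σ} (A : Structure σ) L a t n d c →
                     decodedError A L a (c ∷ ⟨ t , ⟨ n , d ⟩ ⟩ ∷ []) ≡ error A L a t n d c
  decodedError-⟨,⟩ A L a t n d c =
    trans (cong₂ (λ x y → error A L a x (head y) (tail y) c) (head-⟨,⟩ t ⟨ n , d ⟩) (tail-⟨,⟩ t ⟨ n , d ⟩))
          (cong₂ (λ x y → error A L a t x y c) (head-⟨,⟩ n d) (tail-⟨,⟩ n d))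

  embeddableʳ : ∀ {σ} {A : Structure σ} {L a m} {t n d : Vec ℕ m → ℕ} → Computable A →
                Recursive ∅′ t → Recursive ∅′ n → Recursive ∅′ d →
                Recursive ∅′ (λ xs → indicator (em {∃[ c ] Embeds A L a (t xs) (n xs) (d xs) c}))
  embeddableʳ {A = A} {L} {a} {t = t} {n} {d} computable t′ n′ d′ =
    ext (λ xs → indicator-cong (equivalent (t xs) (n xs) (d xs)) em em)
        (Σ₁ʳ {f = decodedError A L a} (decodedErrorʳ computable) ⟨ t′ , ⟨ n′ , d′ ⟩ʳ ⟩ʳ)
    where
    equivalent : ∀ t n d → (∃[ c ] decodedError A L a (c ∷ ⟨ t , ⟨ n , d ⟩ ⟩ ∷ []) ≡ 0) ⇔
                           (∃[ c ] Embeds A L a t n d c)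
    equivalent t n d = mk⇔
      (λ (c , eq) → c , Equivalence.to (error≡0⇔ A L a) (trans (sym (decodedError-⟨,⟩ A L a t n d c)) eq))
      (λ (c , embeds) → c , trans (decodedError-⟨,⟩ A L a t n d c) (Equivalence.from (error≡0⇔ A L a) embeds))

-- Recursive search for a conjecture

conjectureCode : ∀ {k} → Maybe (Fin k) → ℕ
conjectureCode nothing  = 0
conjectureCode (just i) = suc (toℕ i)

first : ∀ {k} {P : Fin k → Set} → (∀ i → Dec (P i)) → Maybe (Fin k)
first {zero}  P? = nothing
first {suc k} P? with P? zero
... | yesᵈ _ = just zero
... | noᵈ _  = Maybe.map suc (first (λ i → P? (suc i)))

first-nothing : ∀ {k} {P : Fin k → Set} (P? : ∀ i → Dec (P i)) → (∀ i → ¬ P i) → first P? ≡ nothing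
first-nothing {zero}  P? ¬P = refl
first-nothing {suc k} P? ¬P with P? zero
... | yesᵈ p = contradiction p (¬P zero)
... | noᵈ _  = cong (Maybe.map suc) (first-nothing (λ i → P? (suc i)) (λ i → ¬P (suc i)))

first-just : ∀ {k} {P : Fin k → Set} (P? : ∀ i → Dec (P i)) i → P i → (∀ j → j ≢ i → ¬ P j) → first P? ≡ just i
first-just P? zero p ¬P with P? zero
... | yesᵈ _ = refl
... | noᵈ ¬p = contradiction p ¬p
first-just P? (suc i) p ¬P with P? zero
... | yesᵈ p₀ = contradiction p₀ (¬P zero λ ())
... | noᵈ _   = cong (Maybe.map suc) (first-just (λ i → P? (suc i)) i p λ j j≢i → ¬P (suc j) λ { refl → j≢i refl })

-- For `b` equal to 1 this is 1, the code of `just zero`. For `b` equal to 0 it is `r` plus the sign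
-- of `r`: shifting a conjecture by `suc` raises its code by one, but leaves the question mark at 0.
firstCode : ℕ → ℕ → ℕ
firstCode b r = b + (1 ∸ b) * (r + (1 ∸ (1 ∸ r)))

firstʳ : ∀ {O m k} {P : Vec ℕ m → Fin k → Set} {P? : ∀ xs i → Dec (P xs i)} →
         (∀ i → Recursive O (λ xs → indicator (P? xs i))) →
         Recursive O (λ xs → conjectureCode (first (P? xs)))
firstʳ {k = zero}  rec = lit 0
firstʳ {k = suc k} {P? = P?} rec =
  ext agree (b +ʳ (lit 1 ∸ʳ b) *ʳ (r +ʳ (lit 1 ∸ʳ (lit 1 ∸ʳ r))))
  where
  b = rec zero
  r = firstʳ (λ i → rec (suc i))
  shift : ∀ {k} (h : Maybe (Fin k)) → firstCode 0 (conjectureCode h) ≡ conjectureCode (Maybe.map suc h)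
  shift nothing  = refl
  shift (just i) = trans (+-identityʳ _) (trans (cong (suc (toℕ i) +_) (cong (1 ∸_) (0∸n≡0 (toℕ i)))) (+-comm (suc (toℕ i)) 1))
  agree : ∀ xs → firstCode (indicator (P? xs zero)) (conjectureCode (first (λ i → P? xs (suc i)))) ≡
                 conjectureCode (first (P? xs))
  agree xs with P? xs zero
  ... | yesᵈ _ = refl
  ... | noᵈ _  = shift (first (λ i → P? xs (suc i)))

search : ∀ {B : Set} → (ℕ → Maybe B) → ℕ → Maybe B
search f zero    = nothing
search f (suc n) = search f n <∣> f n

search-nothing : ∀ {B : Set} {f : ℕ → Maybe B} n → (∀ t → t < n → f t ≡ nothing) → search f n ≡ nothing
search-nothing zero    _  = refl
search-nothing (suc n) eq rewrite search-nothing n (λ t t<n → eq t (m<n⇒m<1+n t<n)) = eq n (n<1+n n)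

search-just : ∀ {B : Set} {f : ℕ → Maybe B} {x t} n → t < n → (∀ s → s < t → f s ≡ nothing) → f t ≡ just x →
              search f n ≡ just x
search-just {t = t} (suc n) t<1+n below eq with t ≟ n
... | yesᵈ refl rewrite search-nothing n below = eq
... | noᵈ t≢n   rewrite search-just n (≤∧≢⇒< (≤-pred t<1+n) t≢n) below eq = refl

searchʳ : ∀ {O m k} {n : Vec ℕ m → ℕ} {f : Vec ℕ m → ℕ → Maybe (Fin k)} → Recursive O n →
          Recursive O {suc m} (λ xs → conjectureCode (f (Vec.tail xs) (Vec.head xs))) →
          Recursive O (λ xs → conjectureCode (search (f xs) (n xs)))
searchʳ {n = n} {f} n′ f′ =
  ext (λ xs → agree (f xs) (n xs))
      (recʳ n′ (lit 0) (var (suc zero) +ʳ (lit 1 ∸ʳ var (suc zero)) *ʳ (f′ [ var zero ∷ʳ drop₂ʳ ]ʳ)))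
  where
  orElse : ∀ {k} (h h′ : Maybe (Fin k)) →
           conjectureCode h + (1 ∸ conjectureCode h) * conjectureCode h′ ≡ conjectureCode (h <∣> h′)
  orElse nothing  h′ = +-identityʳ _
  orElse (just i) h′ = trans (cong (λ z → suc (toℕ i) + z * conjectureCode h′) (0∸n≡0 (toℕ i))) (+-identityʳ _)

  agree : ∀ {k} (f : ℕ → Maybe (Fin k)) n →
          recℕ 0 (λ t z → z + (1 ∸ z) * conjectureCode (f t)) n ≡ conjectureCode (search f n)
  agree f zero    = refl
  agree f (suc n) = trans (cong (λ z → z + (1 ∸ z) * conjectureCode (f n)) (agree f n)) (orElse (search f n) (f n))

-- Convergence

_Eventually : (ℕ → Set) → Set
P Eventually = ∃[ N ] ∀ n → N ≤ n → P n

eventually-map : ∀ {P Q : ℕ → Set} → (∀ n → P n → Q n) → P Eventually → Q Eventually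
eventually-map f (N , p) = N , λ n N≤n → f n (p n N≤n)

eventually-× : ∀ {P Q : ℕ → Set} → P Eventually → Q Eventually → (λ n → P n × Q n) Eventually
eventually-× (N , p) (N′ , q) =
  N ⊔ N′ , λ n N≤n → p n (≤-trans (m≤m⊔n N N′) N≤n) , q n (≤-trans (m≤n⊔m N N′) N≤n)

eventually-∀< : ∀ {P : ℕ → ℕ → Set} T → (∀ t → t < T → P t Eventually) → (λ n → ∀ t → t < T → P t n) Eventually
eventually-∀< zero    _  = 0 , λ _ _ _ ()
eventually-∀< {P} (suc T) ev =
  eventually-map combine
    (eventually-× (ev T (n<1+n T)) (eventually-∀< {P} T λ t t<T → ev t (m<n⇒m<1+n t<T)))
  where
  combine : ∀ n → P T n × (∀ t → t < T → P t n) → ∀ t → t < suc T → P t n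
  combine n (pT , p) t t<1+T with t ≟ T
  ... | yesᵈ refl = pT
  ... | noᵈ t≢T   = p t (≤∧≢⇒< (≤-pred t<1+T) t≢T)

eventually-Fin : ∀ {k} {P : Fin k → ℕ → Set} → (∀ i → P i Eventually) → (λ n → ∀ i → P i n) Eventually
eventually-Fin {zero}  _  = 0 , λ _ _ ()
eventually-Fin {suc k} ev =
  eventually-map (λ { _ (p , _) zero → p ; _ (_ , p) (suc i) → p i })
    (eventually-× (ev zero) (eventually-Fin (λ i → ev (suc i))))

eventually-unique : ∀ {B : Set} {f : ℕ → B} {x y} →
                    (λ n → f n ≡ x) Eventually → (λ n → f n ≡ y) Eventually → x ≡ y
eventually-unique (N , p) (N′ , q) = trans (sym (p (N ⊔ N′) (m≤m⊔n N N′))) (q (N ⊔ N′) (m≤n⊔m N N′))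

-- Copies and the embedding test

module _ {σ : Signature} where

  ≅-sym : ∀ {S A : Structure σ} → S ≅ A → A ≅ S
  ≅-sym {S} {A} (f , eq) = ↔-sym f , λ r xs → sym (trans (eq r (Vec.map (from f) xs)) (cong (A r) (cancel xs)))
    where
    cancel : ∀ {n} (xs : Vec ℕ n) → Vec.map (to f) (Vec.map (from f) xs) ≡ xs
    cancel xs = trans (sym (map-∘ (to f) (from f) xs)) (trans (map-cong (strictlyInverseˡ f) xs) (map-id xs))

  ≅-trans : ∀ {S A B : Structure σ} → S ≅ A → A ≅ B → S ≅ B
  ≅-trans {B = B} (f , eq) (g , eq′) =
    g ↔-∘ f , λ r xs → trans (eq r xs) (trans (eq′ r (Vec.map (to f) xs)) (cong (B r) (sym (map-∘ (to g) (to f) xs))))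

  pullback-≅ : ∀ (A : Structure σ) (g : ℕ ↔ ℕ) → pullback A (to g) ≅ A
  pullback-≅ A g = g , λ _ _ → refl

map-cong-codeSeq : ∀ {f g : ℕ → ℕ} {k} (xs : Vec ℕ k) → (∀ x → x < codeSeq xs → f x ≡ g x) →
                   Vec.map f xs ≡ Vec.map g xs
map-cong-codeSeq []       _  = refl
map-cong-codeSeq (x ∷ xs) eq =
  cong₂ _∷_ (eq x (m<⟨m,n⟩ x (codeSeq xs)))
            (map-cong-codeSeq xs λ y y< → eq y (<-trans y< (n<⟨m,n⟩ x (codeSeq xs))))

f<tabulateSeq : ∀ f n {x} → x < n → f x < tabulateSeq f n
f<tabulateSeq f (suc n) {zero}  _         = m<⟨m,n⟩ (f 0) (tabulateSeq (f ∘ suc) n)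
f<tabulateSeq f (suc n) {suc x} (s≤s x<n) =
  <-trans (f<tabulateSeq (f ∘ suc) n x<n) (n<⟨m,n⟩ (f 0) (tabulateSeq (f ∘ suc) n))

upper-bound : ∀ {B : Set} (f : B → ℕ) xs → ∃[ N ] ∀ x → x ∈ˡ xs → f x < N
upper-bound f []       = 0 , λ _ ()
upper-bound f (y ∷ ys) with upper-bound f ys
... | N , bound = suc (f y) ⊔ N , λ
  { _ (here refl) → m≤m⊔n (suc (f y)) N
  ; x (there x∈)  → ≤-trans (bound x x∈) (m≤n⊔m (suc (f y)) N) }

module _ {σ : Signature} where

  -- ⟨ r , s ⟩ need not code an atom; then neither does ⟨ r , mapSeq c s ⟩, as mapSeq preserves lengths.
  diagram-≅ : ∀ {S A : Structure σ} ((f , _) : S ≅ A) {c r s} → (∀ x → x < s → nth c x ≡ to f x) →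
              ⟨ r , s ⟩ ∈ atomicDiagram S ⇔ ⟨ r , mapSeq c s ⟩ ∈ atomicDiagram A
  diagram-≅ {S} {A} (f , S≡A) {c} {r} {s} c≗f with codeSeq-surjective s
  ... | k , xs , refl = mk⇔ (λ (a , eq , Ta) → forth a Ta (inv a r eq)) (λ (a , eq , Ta) → back a Ta (inv a r eq))
    where
    inv : ∀ (a : Atom σ) r {s} → gödel a ≡ ⟨ r , s ⟩ → symbolNumber σ (proj₁ a) ≡ r × codeSeq (proj₂ a) ≡ s
    inv (r′ , ys) r {s} eq = ⟨,⟩-injective (symbolNumber σ r′) (codeSeq ys) r s eq

    mapped : mapSeq c (codeSeq xs) ≡ codeSeq (Vec.map (to f) xs)
    mapped = trans (mapSeq-codeSeq c xs) (cong codeSeq (map-cong-codeSeq xs c≗f))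

    forth : ∀ (a : Atom σ) → T (holds S a) → symbolNumber σ (proj₁ a) ≡ r × codeSeq (proj₂ a) ≡ codeSeq xs →
            ⟨ r , mapSeq c (codeSeq xs) ⟩ ∈ atomicDiagram A
    forth (r′ , ys) Ta (eqr , eqs) with codeSeq-injective ys xs eqs
    ... | refl = (r′ , Vec.map (to f) ys) , cong₂ ⟨_,_⟩ eqr (sym mapped) , subst T (S≡A r′ ys) Ta

    back : ∀ (a : Atom σ) → T (holds A a) → symbolNumber σ (proj₁ a) ≡ r × codeSeq (proj₂ a) ≡ mapSeq c (codeSeq xs) →
           ⟨ r , codeSeq xs ⟩ ∈ atomicDiagram S
    back (r′ , zs) Ta (eqr , eqs) with codeSeq-injective zs (Vec.map (to f) xs) (trans eqs mapped)
    ... | refl = (r′ , xs) , cong (λ r → ⟨ r , codeSeq xs ⟩) eqr , subst T (sym (S≡A r′ xs)) Ta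

  indicator-holds : ∀ {S : Structure σ} {a} (P? : Dec (gödel a ∈ atomicDiagram S)) →
                    indicator P? ≡ (if holds S a then 1 else 0)
  indicator-holds {S} {a} P? with holds S a in eq
  ... | true  = indicator-yes P? (a , refl , subst T (sym eq) tt)
  ... | false = indicator-no P? λ ∈diagram → subst T eq (gödel∈atomicDiagram⇒holds {S = S} {a} ∈diagram)

if-injective : ∀ {b b′ : Bool} → (if b then 1 else 0) ≡ (if b′ then 1 else 0) → b ≡ b′
if-injective {true}  {true}  _ = refl
if-injective {false} {false} _ = refl

module _ (em : ExcludedMiddle 0ℓ) {σ : Signature} where

  -- Later stages test more, and facts about `S` once visible do not change; so the same `c` works
  -- at the earlier stage.
  Embeds-index-≤ : ∀ {S A : Structure σ} {L a t m n c} → m ≤ n →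
                   Embeds em A L a t n (index S n) c → Embeds em A L a t m (index S m) c
  Embeds-index-≤ {S} m≤n embeds = record
    { distinct = λ x y x<m y<m → distinct x y (<-≤-trans x<m m≤n) (<-≤-trans y<m m≤n)
    ; base     = base
    ; faithful = λ r s r<m s<m →
        trans (trans (bit-index {S = S} (<⇒≤ r<m) (<⇒≤ s<m) em)
                     (sym (bit-index {S = S} (<⇒≤ (<-≤-trans r<m m≤n)) (<⇒≤ (<-≤-trans s<m m≤n)) em)))
              (faithful r s (<-≤-trans r<m m≤n) (<-≤-trans s<m m≤n))
    }
    where open Embeds embeds

  -- The tuple is the preimage of the locking tuple under the isomorphism, and each `c` codes an
  -- initial segment of the isomorphism.
  ≅⇒Embeds : ∀ {S A : Structure σ} → S ≅ A → ∀ (g : ℕ ↔ ℕ) L →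
             ∃[ t ] ∀ n → ∃[ c ] Embeds em A L (tabulateSeq (to g) L) t n (index S n) c
  -- Length `n + t` covers both the arguments below `n` and the entries of the tuple, which are
  -- smaller than its code `t`.
  ≅⇒Embeds {S} {A} S≅A@(f , _) g L = t , λ n → tabulateSeq (to f) (n + t) , record
    { distinct = λ x y x<n y<n eq →
        to-injective f (trans (sym (nth-c n (m≤n⇒m≤n+o t x<n))) (trans eq (nth-c n (m≤n⇒m≤n+o t y<n))))
    ; base     = λ l l<L → begin
        nth (tabulateSeq (to f) (n + t)) (nth t l)
          ≡⟨ cong (nth (tabulateSeq (to f) (n + t))) (nth-tabulateSeq b L l<L) ⟩
        nth (tabulateSeq (to f) (n + t)) (b l)
          ≡⟨ nth-c n (m≤n⇒m≤o+n n (f<tabulateSeq b L l<L)) ⟩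
        to f (b l)
          ≡⟨ strictlyInverseˡ f (to g l) ⟩
        to g l
          ≡⟨ nth-tabulateSeq (to g) L l<L ⟨
        nth (tabulateSeq (to g) L) l
          ∎
    ; faithful = λ r s r<n s<n →
        trans (bit-index {S = S} (<⇒≤ r<n) (<⇒≤ s<n) em)
              (indicator-cong (diagram-≅ {S = S} {A} S≅A {r = r} {s} λ x x<s → nth-c n (m≤n⇒m≤n+o t (<-trans x<s s<n))) em em)
    }
    where
    open ≡-Reasoning
    b : ℕ → ℕ
    b l = from f (to g l)
    t = tabulateSeq b L
    nth-c : ∀ n {x} → x < n + t → nth (tabulateSeq (to f) (n + t)) x ≡ to f x
    nth-c n = nth-tabulateSeq (to f) (n + t)

  -- If the tuple coded by t is never refuted, then a copy of S that starts with this tuple looks,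
  -- at every stage, like a copy of A on which M is locked.
  locked-on-copy : ∀ {H : Set} {S A : Structure σ} (M : FinStr σ → H) {h} {g : ℕ ↔ ℕ} {L} →
                   Locks em A M h g L → ∀ {t} →
                   (∀ n → ∃[ c ] Embeds em A L (tabulateSeq (to g) L) t n (index S n) c) →
                   Σ (ℕ ↔ ℕ) λ β → ∀ m → L ≤ m → M (pullback S (to β) ↾ m) ≡ h
  locked-on-copy {S = S} {A} M {h} {g} {L} locks {t} embeds = β , locked
    where
    open ≡-Reasoning

    nth-base : ∀ {n c} → Embeds em A L (tabulateSeq (to g) L) t n (index S n) c →
               ∀ l → l < L → nth c (nth t l) ≡ to g l
    nth-base E l l<L = trans (Embeds.base E l l<L) (nth-tabulateSeq (to g) L l<L)

    -- Stage 0 suffices, since `base` constrains the whole tuple at every stage.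
    b-injective : ∀ x y → x < L → y < L → nth t x ≡ nth t y → x ≡ y
    b-injective x y x<L y<L eq with embeds 0
    ... | c , E = to-injective g (begin
      to g x           ≡⟨ nth-base E x x<L ⟨
      nth c (nth t x)  ≡⟨ cong (nth c) eq ⟩
      nth c (nth t y)  ≡⟨ nth-base E y y<L ⟩
      to g y           ∎)

    extended = extend-injection (nth t) L b-injective
    β = proj₁ extended

    locked : ∀ m → L ≤ m → M (pullback S (to β) ↾ m) ≡ h
    locked m L≤m = trans (cong M (trans same-atoms same-map)) (locks g′ agrees m L≤m)
      where
      bounds = eventually-∀< {P = λ x n → to β x < n} (suc m) (λ x _ → suc (to β x) , λ _ β<n → β<n)
      symbols = upper-bound (symbolNumber σ ∘ proj₁) (atoms σ m)
      tuples-β = upper-bound (λ a → codeSeq (Vec.map (to β) (proj₂ a))) (atoms σ m)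
      -- At stage `N` the test covers the images under `β` of all numbers up to `m` and of all atoms
      -- over them.
      N = proj₁ bounds ⊔ (proj₁ symbols ⊔ proj₁ tuples-β)

      c = proj₁ (embeds N)
      E = proj₂ (embeds N)
      open Embeds E

      q : ℕ → ℕ
      q x = nth c (to β x)

      β<N : ∀ x → x < suc m → to β x < N
      β<N = proj₂ bounds N (m≤m⊔n (proj₁ bounds) _)

      -- Up to `m`, `q` is a finite partial enumeration of `A` that continues the locking one. A
      -- bijection extending it is needed to apply `locks`.
      extended′ = extend-injection q (suc m) λ x y x≤m y≤m eq →
        to-injective β (distinct (to β x) (to β y) (β<N x x≤m) (β<N y y≤m) eq)
      g′ = proj₁ extended′

      agrees : ∀ x → x < L → to g′ x ≡ to g x
      agrees x x<L = begin
        to g′ x          ≡⟨ proj₂ extended′ x (<-≤-trans x<L (m≤n⇒m≤1+n L≤m)) ⟩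
        nth c (to β x)   ≡⟨ cong (nth c) (proj₂ extended x x<L) ⟩
        nth c (nth t x)  ≡⟨ nth-base E x x<L ⟩
        to g x           ∎

      same-map : pullback A q ↾ m ≡ pullback A (to g′) ↾ m
      same-map = pullback-↾-cong {A = A} λ x x≤m → sym (proj₂ extended′ x (s≤s x≤m))

      same-atom : ∀ r (xs : Vec ℕ (arity σ r)) → (r , xs) ∈ˡ atoms σ m →
                  S r (Vec.map (to β) xs) ≡ A r (Vec.map q xs)
      same-atom r xs a∈ = if-injective (begin
        (if holds S (r , ys) then 1 else 0)
          ≡⟨ indicator-holds {S = S} {r , ys} em ⟨
        χ em (atomicDiagram S) ⟨ symbolNumber σ r , codeSeq ys ⟩
          ≡⟨ bit-index {S = S} (<⇒≤ r<N) (<⇒≤ s<N) em ⟨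
        bit ⟨ symbolNumber σ r , codeSeq ys ⟩ (index S N)
          ≡⟨ faithful (symbolNumber σ r) (codeSeq ys) r<N s<N ⟩
        χ em (atomicDiagram A) ⟨ symbolNumber σ r , mapSeq c (codeSeq ys) ⟩
          ≡⟨ cong (λ s → χ em (atomicDiagram A) ⟨ symbolNumber σ r , s ⟩) mapped ⟩
        χ em (atomicDiagram A) ⟨ symbolNumber σ r , codeSeq (Vec.map q xs) ⟩
          ≡⟨ indicator-holds {S = A} {r , Vec.map q xs} em ⟩
        (if holds A (r , Vec.map q xs) then 1 else 0)
          ∎)
        where
        ys = Vec.map (to β) xs
        r<N : symbolNumber σ r < N
        r<N = ≤-trans (proj₂ symbols (r , xs) a∈)
                (≤-trans (m≤m⊔n (proj₁ symbols) (proj₁ tuples-β)) (m≤n⊔m (proj₁ bounds) _))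
        s<N : codeSeq ys < N
        s<N = ≤-trans (proj₂ tuples-β (r , xs) a∈)
                (≤-trans (m≤n⊔m (proj₁ symbols) (proj₁ tuples-β)) (m≤n⊔m (proj₁ bounds) _))
        mapped : mapSeq c (codeSeq ys) ≡ codeSeq (Vec.map q xs)
        mapped = trans (mapSeq-codeSeq c ys) (cong codeSeq (sym (map-∘ (nth c) (to β) xs)))

      same-atoms : pullback S (to β) ↾ m ≡ pullback A q ↾ m
      same-atoms = ↾-cong {S = pullback S (to β)} {pullback A q} λ (r , xs) a∈ → same-atom r xs a∈

-- Limits of guesses

module _ (em : ExcludedMiddle 0ℓ) {k} {P : Fin k → ℕ → ℕ → Set} (P? : ∀ i t n → Dec (P i t n))
       (antitone : ∀ {i t m n} → m ≤ n → P i t n → P i t m) where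

  guess : ℕ → Maybe (Fin k)
  guess n = search (λ t → first (λ i → P? i t n)) n

  eventually-refuted : ∀ {i t} → ¬ (∀ n → P i t n) → (λ n → ¬ P i t n) Eventually
  eventually-refuted {i} {t} ¬all with em {∃[ n ] ¬ P i t n}
  ... | yesᵈ (N , ¬p) = N , λ n N≤n p → ¬p (antitone N≤n p)
  ... | noᵈ ¬∃        = contradiction (λ n → decidable-stable em λ ¬p → ¬∃ (n , ¬p)) ¬all

  -- Let `t₀` be the least tuple never refuted for `i`. Each smaller tuple is eventually refuted for
  -- every member, and `t₀` for every member but `i`. These are finitely many refutations, and each
  -- is permanent by `antitone`.
  guess-converges : ∀ i → (∃[ t ] ∀ n → P i t n) → (∀ j → j ≢ i → ∀ t → ¬ (∀ n → P j t n)) →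
                    (λ n → guess n ≡ just i) Eventually
  guess-converges i (t , always) refuted with least-zero (λ t → 1 ∸ indicator (em {∀ n → P i t n})) t
                                              (cong (1 ∸_) (indicator-yes em always))
  ... | t₀ , eq , below =
    eventually-map correct
      -- `guess n` tries only tuples below `n`, so `t₀` has to come into range first.
      (eventually-× (suc t₀ , λ _ t₀<n → t₀<n)
        (eventually-× (eventually-∀< {λ t n → ∀ j → ¬ P j t n} t₀ λ t t<t₀ →
                         eventually-Fin λ j → eventually-refuted (refuted-below t t<t₀ j))
                      (eventually-Fin {P = λ j n → j ≢ i → ¬ P j t₀ n} others)))
    where
    always₀ : ∀ n → P i t₀ n
    always₀ = 1∸indicator≡0 em eq

    refuted-below : ∀ t → t < t₀ → ∀ j → ¬ (∀ n → P j t n)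
    refuted-below t t<t₀ j all with j Fin.≟ i
    ... | noᵈ j≢i   = refuted j j≢i t all
    ... | yesᵈ refl with below t t<t₀
    ... | v , ≡suc with () ← trans (sym ≡suc) (cong (1 ∸_) (indicator-yes em all))

    others : ∀ j → (λ n → j ≢ i → ¬ P j t₀ n) Eventually
    others j with j Fin.≟ i
    ... | yesᵈ j≡i = 0 , λ _ _ j≢i → contradiction j≡i j≢i
    ... | noᵈ j≢i  = eventually-map (λ _ ¬p _ → ¬p) (eventually-refuted (refuted j j≢i t₀))

    correct : ∀ n → t₀ < n × (∀ t → t < t₀ → ∀ j → ¬ P j t n) × (∀ j → j ≢ i → ¬ P j t₀ n) → guess n ≡ just i
    correct n (t₀<n , lower , rest) =
      search-just n t₀<n (λ t t<t₀ → first-nothing (λ j → P? j t n) (lower t t<t₀))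
                         (first-just (λ j → P? j t₀ n) i (always₀ n) rest)

-- The learner computable from the halting problem

codeHS≡conjectureCode : ∀ {σ k} (K : Family σ k) (h : HS K) → conjectureCode h ≡ codeHS K h
codeHS≡conjectureCode K nothing  = refl
codeHS≡conjectureCode K (just i) = refl

recursive⇒ComputableIn : ∀ {σ k} {K : Family σ k} {M : Learner K} {O} {f : Vec ℕ 2 → ℕ} → Recursive O f →
                         (∀ D → f (codeFinStr D) ≡ codeHS K (M D)) → _ComputableIn_ {K = K} M O
recursive⇒ComputableIn {O = O} f′ eq =
  program f′ , λ S _ n → subst (O ⊢ program f′ [ codeFinStr (S ↾ n) ]↓_) (eq (S ↾ n)) (halts f′ (codeFinStr (S ↾ n)))

-- A tuple that is never refuted yields a copy of `S` on which `M` converges to `just j`. As `M`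
-- learns the family, this structure is a copy of both `K i` and `K j`.
refuted : ∀ (em : ExcludedMiddle 0ℓ) {σ k} (K : Family σ k) → PairwiseNonIsomorphic K →
          ∀ (M : Learner K) → Learns K M →
          ∀ {j} (g : ℕ ↔ ℕ) L → Locks em (K j) M (just j) g L →
          ∀ {S i} → S ≅ K i → j ≢ i → ∀ t →
          ¬ (∀ n → ∃[ c ] Embeds em (K j) L (tabulateSeq (to g) L) t n (index S n) c)
refuted em K nonIso M learns {j} g L locks {S} {i} S≅Ki j≢i t embeds =
  nonIso j i j≢i (≅-trans {S = K j} {S′} {K i} (≅-sym {S = S′} {K j} S′≅Kj) S′≅Ki)
  where
  copy = locked-on-copy em {S = S} {K j} M {just j} {g} {L} locks {t} embeds
  S′ = pullback S (to (proj₁ copy))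

  S′≅Ki : S′ ≅ K i
  S′≅Ki = ≅-trans {S = S′} {S} {K i} (pullback-≅ S (proj₁ copy)) S≅Ki

  S′≅Kj : S′ ≅ K j
  S′≅Kj = Equivalence.to (learns S′ (i , S′≅Ki) j) (L , proj₂ copy)

theorem3p1 : ExcludedMiddle 0ℓ →
    ∀ (σ : Signature) (k : ℕ) (K : Family σ k) →
    (∀ i → Computable (K i)) →
    PairwiseNonIsomorphic K →
    Learnable K →
    LearnableIn ∅′ K
theorem3p1 em σ k K computable nonIso (M , learns) = 
  M′ , learns′ , recursive⇒ComputableIn {M = M′} learnerCodeʳ (λ D → codeHS≡conjectureCode K (M′ D))
  where
  lock : ∀ i → Σ (ℕ ↔ ℕ) λ g → ∃[ L ] Locks em (K i) M (just i) g L
  lock i = locking-pair em (K i) M (just i) λ g →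
    Equivalence.from (learns (pullback (K i) (to g)) (i , pullback-≅ (K i) g) i) (pullback-≅ (K i) g)

  L base : Fin k → ℕ
  L i    = proj₁ (proj₂ (lock i))
  base i = tabulateSeq (to (proj₁ (lock i))) (L i)

  Survives : ℕ → Fin k → ℕ → ℕ → Set
  Survives d i t n = ∃[ c ] Embeds em (K i) (L i) (base i) t n d c

  M′ : Learner K
  M′ (n , D) = search (λ t → first (λ i → em {Survives (canonicalIndex (List.map gödel D)) i t n})) n

  -- `M′` uses its input only through the stage and the canonical index, so it extends to all pairs
  -- of numbers, whether or not they code a finite structure.
  learnerCode : Vec ℕ 2 → ℕ
  learnerCode xs = conjectureCode
    (search (λ t → first (λ i → em {Survives (Vec.lookup xs (suc zero)) i t (Vec.lookup xs zero)})) (Vec.lookup xs zero))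

  learnerCodeʳ : Recursive ∅′ learnerCode
  learnerCodeʳ = searchʳ (var zero) (firstʳ {P? = λ xs i → em} λ i →
    -- The search variable precedes the stage and the index; `ext` turns its lookup into the
    -- `Vec.head` that `searchʳ` expects.
    embeddableʳ em (computable i) (ext (λ { (_ ∷ _) → refl }) (var zero)) (weaken (var zero)) (weaken (var (suc zero))))

  converges : ∀ {S i} → S ≅ K i → _on_ConvergesTo_ {K = K} M′ S (just i)
  converges {S} {i} S≅Ki =
    guess-converges em {P = λ i t n → Survives (index S n) i t n} (λ _ _ _ → em) antitone i
      (≅⇒Embeds em {S = S} {A = K i} S≅Ki (proj₁ (lock i)) (L i))
      (λ j j≢i → refuted em K nonIso M learns (proj₁ (lock j)) (L j) (proj₂ (proj₂ (lock j))) {S} {i} S≅Ki j≢i)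
    where
    antitone : ∀ {i t m n} → m ≤ n → Survives (index S n) i t n → Survives (index S m) i t m
    antitone {i} {t} m≤n (c , E) = c , Embeds-index-≤ em {S = S} {K i} {L i} {base i} {t} m≤n E

  learns′ : Learns K M′
  learns′ S (j , S≅Kj) i = mk⇔ to′ converges
    where
    -- On the copy `S` of `K j` the limit is `just j`, and limits are unique.
    to′ : _on_ConvergesTo_ {K = K} M′ S (just i) → S ≅ K i
    to′ converges-i =
      subst (λ i → S ≅ K i) (just-injective (eventually-unique (converges S≅Kj) converges-i)) S≅Kj
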